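{- Let ten lines in the Euclidean plane be given by polar coordinates $(r_i,\theta_i)$, $i=1,\dots,10$, and write $s_{ij}=\sin(\theta_j-\theta_i)$. Suppose that the triangles $(2,4,6)$, $(1,5,9)$, $(1,5,10)$, $(1,5,7)$ are positively oriented and the triangles $(1,3,7)$, $(1,4,7)$, $(3,5,8)$, $(2,8,9)$, $(6,7,10)$ are negatively oriented, where for each of these nine triangles $(i,j,k)$ we have $0<\theta_i<\theta_j<\theta_k<180$. Then $$s_{89}\,s_{1,10}\,s_{24}\,s_{35}\,s_{67}+s_{46}\,s_{19}\,s_{7,10}\,s_{35}\,s_{28}-s_{46}\,s_{38}\,s_{7,10}\,s_{29}\,s_{15}>0 .$$
   Context: Angles are in degrees. A line with polar coordinates $(r,\theta)$ is the line $\{(p,q)\in\mathbb{R}^2: p\cos\theta+q\sin\theta=r\}$, i.e. $r$ is the perpendicular distance from the origin and $\theta$ is the angle the perpendicular makes with the polar direction. No ordering $\theta_i<\theta_j$ for $i<j$ is assumed except those specified. For three lines $i,j,k$ with $\theta_i<\theta_j<\theta_k$, the triangle $(i,j,k)$ is called positively oriented if $r_i\sin(\theta_k-\theta_j)-r_j\sin(\theta_k-\theta_i)+r_k\sin(\theta_j-\theta_i)>0$ (geometrically: the origin lies in an unbounded face of the arrangement of the three lines bounded by three edges) and negatively oriented if $-r_i\sin(\theta_k-\theta_j)+r_j\sin(\theta_k-\theta_i)-r_k\sin(\theta_j-\theta_i)>0$ (the origin lies in an unbounded face with two edges). -}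

module Defs where

open import Data.Bool.Base using (true; T)
open import Data.Fin.Base using (Fin; zero; suc)
open import Data.Integer.Base as ℤ using ()
import Data.Integer.Properties as ℤₚ
open import Data.Nat.Base as ℕ using (ℕ; zero; suc)
import Data.Nat.Properties as ℕₚ
open import Data.Product.Base using (∃-syntax; _×_; _,_; proj₁; proj₂)
open import Data.Rational as ℚ using (ℚ; 0ℚ; 1ℚ; ½)
import Data.Rational.Properties as ℚₚ
open import Data.Sum.Base using (inj₁; inj₂)
open import Relation.Nullary.Decidable using (from-yes)
open import Relation.Binary.PropositionalEquality
  using (_≡_; refl; sym; trans; cong; cong₂; subst; subst₂)

-- A real is a Cauchy sequence of rationals.  In this module _+_, _*_, _<_, … are
-- the operations of ℚ; below it they are those of ℝ.

module RationalSequences where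

  open import Data.Rational using (_+_; _*_; _-_; -_; ∣_∣; _≤_; _<_; _/_; positive; nonNegative)
  open import Data.Rational.Properties
  open import Data.Rational.Solver using (module +-*-Solver)
  open +-*-Solver using (solve; _:+_; _:*_; _:-_; :-_; _:=_; con)

  Cauchy : (ℕ → ℚ) → Set
  Cauchy x = ∀ ε → 0ℚ < ε → ∃[ N ] (∀ m n → N ℕ.≤ m → N ℕ.≤ n → ∣ x m - x n ∣ < ε)

  Σ< : ℕ → (ℕ → ℚ) → ℚ
  Σ< zero    f = 0ℚ
  Σ< (suc n) f = Σ< n f + f n

  -- term x k = xᵏ / k!
  term : ℚ → ℕ → ℚ
  term x zero    = 1ℚ
  term x (suc k) = term x k * (x * (ℤ.+ 1 / suc k))

  -- The k-th derivatives of sin and cos at 0.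
  sinCoeff cosCoeff : ℕ → ℚ
  sinCoeff zero    = 0ℚ
  sinCoeff (suc k) = cosCoeff k
  cosCoeff zero    = 1ℚ
  cosCoeff (suc k) = - sinCoeff k

  taylor : (ℕ → ℚ) → ℕ → ℚ → ℚ
  taylor c n x = Σ< n (λ k → c k * term x k)

  sinPoly cosPoly : ℕ → ℚ → ℚ
  sinPoly = taylor sinCoeff
  cosPoly = taylor cosCoeff

  -- The iteration x ↦ x + cos x converges to the zero π/2 of cos; truncating the
  -- series at stage n does not affect the limit.
  halfPiSeq : ℕ → ℚ
  halfPiSeq zero    = 0ℚ
  halfPiSeq (suc n) = halfPiSeq n + cosPoly n (halfPiSeq n)

  ≤-by : ∀ {p q r} → 0ℚ ≤ r → q ≡ p + r → p ≤ q
  ≤-by {p} {q} {r} 0≤r eq =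
    subst₂ _≤_ (+-identityʳ p) (sym eq) (+-monoʳ-≤ p 0≤r)

  0≤-+ : ∀ {p q} → 0ℚ ≤ p → 0ℚ ≤ q → 0ℚ ≤ p + q
  0≤-+ = +-mono-≤

  *-monoˡ : ∀ {r p q} → 0ℚ ≤ r → p ≤ q → r * p ≤ r * q
  *-monoˡ {r} 0≤r p≤q = *-monoˡ-≤-nonNeg r {{nonNegative 0≤r}} p≤q

  *-monoʳ : ∀ {r p q} → 0ℚ ≤ r → p ≤ q → p * r ≤ q * r
  *-monoʳ {r} 0≤r p≤q = *-monoʳ-≤-nonNeg r {{nonNegative 0≤r}} p≤q

  0≤-* : ∀ {p q} → 0ℚ ≤ p → 0ℚ ≤ q → 0ℚ ≤ p * q
  0≤-* {p} {q} 0≤p 0≤q = subst (_≤ p * q) (*-zeroʳ p) (*-monoˡ 0≤p 0≤q)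

  0<-* : ∀ {p q} → 0ℚ < p → 0ℚ < q → 0ℚ < p * q
  0<-* {p} {q} 0<p 0<q = subst (_< p * q) (*-zeroʳ p) (*-monoʳ-<-pos p {{positive 0<p}} 0<q)

  *-mono-≤′ : ∀ {p q r s} → 0ℚ ≤ q → 0ℚ ≤ r → p ≤ q → r ≤ s → p * r ≤ q * s
  *-mono-≤′ 0≤q 0≤r p≤q r≤s = ≤-trans (*-monoʳ 0≤r p≤q) (*-monoˡ 0≤q r≤s)

  0≤-∸ : ∀ {p q} → p ≤ q → 0ℚ ≤ q - p
  0≤-∸ {p} {q} p≤q = subst (_≤ q - p) (+-inverseʳ p) (+-monoˡ-≤ (- p) p≤q)

  0≤x² : ∀ x → 0ℚ ≤ x * x
  0≤x² x with ≤-total 0ℚ x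
  ... | inj₁ 0≤x = 0≤-* 0≤x 0≤x
  ... | inj₂ x≤0 = subst (0ℚ ≤_) (solve 1 (λ x → (:- x) :* (:- x) := x :* x) refl x)
                     (0≤-* (neg-antimono-≤ x≤0) (neg-antimono-≤ x≤0))

  ∣∣-bound : ∀ {p q} → p ≤ q → - p ≤ q → ∣ p ∣ ≤ q
  ∣∣-bound {p} p≤q -p≤q with ∣p∣≡p∨∣p∣≡-p p
  ... | inj₁ eq = subst (_≤ _) (sym eq) p≤q
  ... | inj₂ eq = subst (_≤ _) (sym eq) -p≤q

  ∣-∣-sym : ∀ p q → ∣ p - q ∣ ≡ ∣ q - p ∣
  ∣-∣-sym p q = trans (cong ∣_∣ (solve 2 (λ p q → p :- q := :- (q :- p)) refl p q)) (∣-p∣≡∣p∣ (q - p))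

  ∣-∣-triangle : ∀ p q r → ∣ p - r ∣ ≤ ∣ p - q ∣ + ∣ q - r ∣
  ∣-∣-triangle p q r =
    subst (λ e → ∣ e ∣ ≤ ∣ p - q ∣ + ∣ q - r ∣)
      (solve 3 (λ p q r → (p :- q) :+ (q :- r) := p :- r) refl p q r)
      (∣p+q∣≤∣p∣+∣q∣ (p - q) (q - r))

  half+half : ∀ ε → ½ * ε + ½ * ε ≡ ε
  half+half = solve 1 (λ ε → con ½ :* ε :+ con ½ :* ε := ε) refl

  0<half : ∀ {ε} → 0ℚ < ε → 0ℚ < ½ * ε
  0<half = 0<-* (positive⁻¹ ½)

  +-halves : ∀ {p q ε} → p < ½ * ε → q < ½ * ε → p + q < ε
  +-halves {ε = ε} p< q< = subst (_ <_) (half+half ε) (+-mono-< p< q<)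

  -- Natural numbers inside ℚ.

  nat : ℕ → ℚ
  nat n = ℤ.+ n / 1

  nat-suc : ∀ n → nat (suc n) ≡ 1ℚ + nat n
  nat-suc n = toℚᵘ-injective (ℚᵘₚ.≃-trans (toℚᵘ-fromℚᵘ (mkℚᵘ (ℤ.+ suc n) 0))
      (ℚᵘₚ.≃-sym (ℚᵘₚ.≃-trans (toℚᵘ-homo-+ 1ℚ (nat n))
        (ℚᵘₚ.≃-trans (ℚᵘₚ.+-congʳ (ℚ.toℚᵘ 1ℚ) (toℚᵘ-fromℚᵘ (mkℚᵘ (ℤ.+ n) 0)))
          (*≡* (trans (ℤₚ.*-identityʳ _) (trans (cong (ℤ._+_ (ℤ.+ 1)) (ℤₚ.*-identityʳ (ℤ.+ n)))
            (sym (ℤₚ.*-identityʳ (ℤ.+ suc n))))))))))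
    where
    open import Data.Rational.Unnormalised.Base using (mkℚᵘ; *≡*)
    import Data.Rational.Unnormalised.Properties as ℚᵘₚ

  nat-+ : ∀ m n → nat (m ℕ.+ n) ≡ nat m + nat n
  nat-+ zero    n = sym (+-identityˡ (nat n))
  nat-+ (suc m) n = trans (nat-suc (m ℕ.+ n)) (trans (cong (1ℚ +_) (nat-+ m n))
    (trans (sym (+-assoc 1ℚ (nat m) (nat n))) (cong (_+ nat n) (sym (nat-suc m)))))

  0≤nat : ∀ n → 0ℚ ≤ nat n
  0≤nat zero    = ≤-refl
  0≤nat (suc n) = subst (0ℚ ≤_) (sym (nat-suc n)) (0≤-+ (nonNegative⁻¹ 1ℚ) (0≤nat n))

  nat-mono : ∀ {m n} → m ℕ.≤ n → nat m ≤ nat n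
  nat-mono {n = n} ℕ.z≤n = 0≤nat n
  nat-mono {suc m} {suc n} (ℕ.s≤s m≤n) =
    subst₂ _≤_ (sym (nat-suc m)) (sym (nat-suc n)) (+-monoʳ-≤ 1ℚ (nat-mono m≤n))

  recip : ℕ → ℚ
  recip k = ℤ.+ 1 / suc k

  0≤recip : ∀ k → 0ℚ ≤ recip k
  0≤recip k = nonNegative⁻¹ (recip k) {{normalize-nonNeg 1 (suc k)}}

  nat*recip : ∀ k → nat (suc k) * recip k ≡ 1ℚ
  nat*recip k = toℚᵘ-injective (ℚᵘₚ.≃-trans (toℚᵘ-homo-* (nat (suc k)) (recip k))
      (ℚᵘₚ.≃-trans (ℚᵘₚ.*-cong (toℚᵘ-fromℚᵘ (mkℚᵘ (ℤ.+ suc k) 0)) (toℚᵘ-fromℚᵘ (mkℚᵘ (ℤ.+ 1) k)))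
        (*≡* (cong ℤ.+_ (trans (ℕₚ.*-identityʳ _) (trans (ℕₚ.*-identityʳ _)
          (sym (trans (ℕₚ.+-identityʳ _) (ℕₚ.+-identityʳ _)))))))))
    where
    open import Data.Rational.Unnormalised.Base using (mkℚᵘ; *≡*)
    import Data.Rational.Unnormalised.Properties as ℚᵘₚ

  archimedean : ∀ p → ∃[ n ] p ≤ nat n
  archimedean p@(ℚ.mkℚ (ℤ.+ n) d _) = n ,
    toℚᵘ-cancel-≤ (ℚᵘₚ.≤-respʳ-≃ (ℚᵘₚ.≃-sym (toℚᵘ-fromℚᵘ (mkℚᵘ (ℤ.+ n) 0)))
      (*≤* (subst₂ ℤ._≤_ (ℤₚ.pos-* n 1) (ℤₚ.pos-* n (suc d))
        (ℤ.+≤+ (ℕₚ.*-monoʳ-≤ n (ℕ.s≤s (ℕ.z≤n {d})))))))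
    where
    open import Data.Rational.Unnormalised.Base using (mkℚᵘ; *≤*)
    import Data.Rational.Unnormalised.Properties as ℚᵘₚ
  archimedean p@(ℚ.mkℚ ℤ.-[1+ n ] d _) = 0 , ℚ.*≤* ℤ.-≤+

  -- If 0 < ε then every p is below some multiple of ε.
  archimedean-ε : ∀ p ε → 0ℚ < ε → ∃[ n ] p ≤ nat n * ε
  archimedean-ε p ε 0<ε =
    let instance ε≢0 = ℚ.>-nonZero 0<ε
        (n , p/ε≤n) = archimedean (p * (ℚ.1/ ε))
    in n , subst (_≤ nat n * ε)
             (trans (*-assoc p (ℚ.1/ ε) ε) (trans (cong (p *_) (*-inverseˡ ε)) (*-identityʳ p)))
             (*-monoʳ (<⇒≤ 0<ε) p/ε≤n)

  cauchy-from : ∀ {x : ℕ → ℚ} → (∀ ε → 0ℚ < ε → ∃[ N ] (∀ m → N ℕ.≤ m → ∣ x m - x N ∣ < ε)) → Cauchy x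
  cauchy-from {x} h ε 0<ε =
    let (N , close) = h (½ * ε) (0<half 0<ε) in
    N , λ m n N≤m N≤n → ≤-<-trans (∣-∣-triangle (x m) (x N) (x n))
          (+-halves (close m N≤m) (subst (_< ½ * ε) (∣-∣-sym (x n) (x N)) (close n N≤n)))

  cauchy-const : ∀ q → Cauchy (λ _ → q)
  cauchy-const q ε 0<ε = 0 , λ _ _ _ _ → subst (λ d → ∣ d ∣ < ε) (sym (+-inverseʳ q)) 0<ε

  cauchy-neg : ∀ {x} → Cauchy x → Cauchy (λ n → - x n)
  cauchy-neg {x} cx ε 0<ε =
    let (N , close) = cx ε 0<ε in
    N , λ m n N≤m N≤n → subst (_< ε)
      (trans (∣-∣-sym (x m) (x n)) (cong ∣_∣ (solve 2 (λ p q → q :- p := :- p :- :- q) refl (x m) (x n))))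
      (close m n N≤m N≤n)

  cauchy-+ : ∀ {x y} → Cauchy x → Cauchy y → Cauchy (λ n → x n + y n)
  cauchy-+ {x} {y} cx cy ε 0<ε =
    let (M , closeˣ) = cx (½ * ε) (0<half 0<ε)
        (N , closeʸ) = cy (½ * ε) (0<half 0<ε)
    in M ℕ.⊔ N , λ m n M⊔N≤m M⊔N≤n →
      subst (λ d → ∣ d ∣ < ε)
        (solve 4 (λ a b c d → (a :- c) :+ (b :- d) := (a :+ b) :- (c :+ d)) refl (x m) (y m) (x n) (y n))
        (≤-<-trans (∣p+q∣≤∣p∣+∣q∣ (x m - x n) (y m - y n))
          (+-halves
            (closeˣ m n (ℕₚ.m⊔n≤o⇒m≤o M N M⊔N≤m) (ℕₚ.m⊔n≤o⇒m≤o M N M⊔N≤n))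
            (closeʸ m n (ℕₚ.m⊔n≤o⇒n≤o M N M⊔N≤m) (ℕₚ.m⊔n≤o⇒n≤o M N M⊔N≤n))))

  Σ<-nonNeg : ∀ n {f} → (∀ k → 0ℚ ≤ f k) → 0ℚ ≤ Σ< n f
  Σ<-nonNeg zero    0≤f = ≤-refl
  Σ<-nonNeg (suc n) 0≤f = 0≤-+ (Σ<-nonNeg n 0≤f) (0≤f n)

  Σ<-summand : ∀ n {f} → (∀ k → 0ℚ ≤ f k) → ∀ {k} → k ℕ.< n → f k ≤ Σ< n f
  Σ<-summand (suc n) {f} 0≤f {k} k<1+n with ℕₚ.m≤n⇒m<n∨m≡n (ℕₚ.≤-pred k<1+n)
  ... | inj₁ k<n  = ≤-trans (Σ<-summand n 0≤f k<n) (≤-by (0≤f n) refl)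
  ... | inj₂ refl = ≤-by (Σ<-nonNeg n 0≤f) (+-comm (Σ< n f) (f n))

  bounded : ∀ {x} → Cauchy x → ∃[ B ] (0ℚ < B × (∀ n → ∣ x n ∣ ≤ B))
  bounded {x} cx = B , <-≤-trans 0<1 1≤B , ∣x∣≤B
    where
    N = proj₁ (cx 1ℚ (positive⁻¹ 1ℚ))
    close = proj₂ (cx 1ℚ (positive⁻¹ 1ℚ))
    0<1 = positive⁻¹ 1ℚ
    S = Σ< (suc N) (λ k → ∣ x k ∣)
    B = S + 1ℚ
    0≤∣x∣ = λ k → 0≤∣p∣ (x k)
    1≤B : 1ℚ ≤ B
    1≤B = ≤-by (Σ<-nonNeg (suc N) 0≤∣x∣) (+-comm S 1ℚ)
    ∣x∣≤B : ∀ n → ∣ x n ∣ ≤ B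
    ∣x∣≤B n with ℕₚ.≤-total n N
    ... | inj₁ n≤N = ≤-trans (Σ<-summand (suc N) 0≤∣x∣ (ℕ.s≤s n≤N)) (≤-by (<⇒≤ 0<1) refl)
    ... | inj₂ N≤n = begin
      ∣ x n ∣                   ≡⟨ cong ∣_∣ (solve 2 (λ a b → a := b :+ (a :- b)) refl (x n) (x N)) ⟩
      ∣ x N + (x n - x N) ∣     ≤⟨ ∣p+q∣≤∣p∣+∣q∣ (x N) (x n - x N) ⟩
      ∣ x N ∣ + ∣ x n - x N ∣   ≤⟨ +-mono-≤ (Σ<-summand (suc N) 0≤∣x∣ ℕₚ.≤-refl)
                                    (<⇒≤ (close n N N≤n ℕₚ.≤-refl)) ⟩
      B                         ∎
      where open ≤-Reasoning

  cauchy-* : ∀ {x y} → Cauchy x → Cauchy y → Cauchy (λ n → x n * y n)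
  cauchy-* {x} {y} cx cy ε 0<ε =
    let (A , 0<A , ∣x∣≤A) = bounded {x} cx
        (B , 0<B , ∣y∣≤B) = bounded {y} cy
        (M , closeˣ) = cx (scale B 0<B) (0<scale B 0<B)
        (N , closeʸ) = cy (scale A 0<A) (0<scale A 0<A)
    in M ℕ.⊔ N , λ m n M⊔N≤m M⊔N≤n →
      let dx = closeˣ m n (ℕₚ.m⊔n≤o⇒m≤o M N M⊔N≤m) (ℕₚ.m⊔n≤o⇒m≤o M N M⊔N≤n)
          dy = closeʸ m n (ℕₚ.m⊔n≤o⇒n≤o M N M⊔N≤m) (ℕₚ.m⊔n≤o⇒n≤o M N M⊔N≤n)
      in subst (λ d → ∣ d ∣ < ε)
        (solve 4 (λ a b c d → (b :* (a :- c)) :+ (c :* (b :- d)) := (a :* b) :- (c :* d)) refl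
          (x m) (y m) (x n) (y n))
        (≤-<-trans (∣p+q∣≤∣p∣+∣q∣ (y m * (x m - x n)) (x n * (y m - y n)))
          (+-halves (small (y m) (∣y∣≤B m) 0<B dx) (small (x n) (∣x∣≤A n) 0<A dy)))
    where
    scale : ∀ C → 0ℚ < C → ℚ
    scale C 0<C = (½ * ε) * (ℚ.1/_ C {{ℚ.>-nonZero 0<C}})
    C*scale : ∀ C 0<C → C * scale C 0<C ≡ ½ * ε
    C*scale C 0<C = let instance C≢0 = ℚ.>-nonZero 0<C in
      trans (solve 3 (λ c e i → c :* (e :* i) := e :* (c :* i)) refl C (½ * ε) (ℚ.1/ C))
        (trans (cong ((½ * ε) *_) (*-inverseʳ C)) (*-identityʳ (½ * ε)))
    0<scale : ∀ C 0<C → 0ℚ < scale C 0<C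
    0<scale C 0<C = 0<-* (0<half 0<ε)
      (positive⁻¹ _ {{1/pos⇒pos C {{positive 0<C}}}})
    small : ∀ p {d C} → ∣ p ∣ ≤ C → (0<C : 0ℚ < C) → ∣ d ∣ < scale C 0<C → ∣ p * d ∣ < ½ * ε
    small p {d} {C} ∣p∣≤C 0<C ∣d∣< = begin-strict
      ∣ p * d ∣        ≡⟨ ∣p*q∣≡∣p∣*∣q∣ p d ⟩
      ∣ p ∣ * ∣ d ∣    ≤⟨ *-monoʳ (0≤∣p∣ d) ∣p∣≤C ⟩
      C * ∣ d ∣        <⟨ *-monoʳ-<-pos C {{positive 0<C}} ∣d∣< ⟩
      C * scale C 0<C  ≡⟨ C*scale C 0<C ⟩
      ½ * ε            ∎
      where open ≤-Reasoning

  -- A sequence of nonnegative bounds that eventually shrinks by 3/4 at each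
  -- step becomes arbitrarily small; if the steps of x are controlled by it, it
  -- bounds the oscillation of x.

  ¾ ¼ : ℚ
  ¾ = ℤ.+ 3 / 4
  ¼ = ℤ.+ 1 / 4

  geometric : ∀ (P : ℕ → ℚ) N₀ → (∀ n → 0ℚ ≤ P n) → (∀ n → N₀ ℕ.≤ n → P (suc n) ≤ ¾ * P n) →
              ∀ ε → 0ℚ < ε → ∃[ N ] (N₀ ℕ.≤ N × P N < ε)
  geometric P N₀ 0≤P shrink ε 0<ε =
    let (j , 3P≤jε) = archimedean-ε (nat 3 * P N₀) ε 0<ε
        3+j>0 = <-≤-trans (positive⁻¹ 1ℚ)
                  (subst (1ℚ ≤_) (sym (nat-suc (2 ℕ.+ j))) (≤-by (0≤nat (2 ℕ.+ j)) refl))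
    in N₀ ℕ.+ j , ℕₚ.m≤m+n N₀ j ,
       *-cancelˡ-<-nonNeg (nat (3 ℕ.+ j)) {{nonNegative (<⇒≤ 3+j>0)}}
         (≤-<-trans (decay j) (≤-<-trans 3P≤jε
           (*-monoˡ-<-pos ε {{positive 0<ε}} (j<3+j j))))
    where
    j<3+j : ∀ j → nat j < nat (3 ℕ.+ j)
    j<3+j j = subst₂ _<_ (+-identityʳ (nat j))
      (trans (+-comm (nat j) (nat 3)) (sym (nat-+ 3 j)))
      (+-monoʳ-< (nat j) (positive⁻¹ (nat 3)))
    decay : ∀ j → nat (3 ℕ.+ j) * P (N₀ ℕ.+ j) ≤ nat 3 * P N₀
    decay zero    = ≤-reflexive (cong (λ n → nat 3 * P n) (ℕₚ.+-identityʳ N₀))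
    decay (suc j) = begin
      nat (3 ℕ.+ suc j) * P (N₀ ℕ.+ suc j)    ≡⟨ cong₂ (λ a n → a * P n) (nat-+ 3 (suc j)) (ℕₚ.+-suc N₀ j) ⟩
      (nat 3 + nat (suc j)) * P (suc (N₀ ℕ.+ j))
        ≤⟨ *-monoˡ (0≤-+ (0≤nat 3) (0≤nat (suc j))) (shrink (N₀ ℕ.+ j) (ℕₚ.m≤m+n N₀ j)) ⟩
      (nat 3 + nat (suc j)) * (¾ * P (N₀ ℕ.+ j))  ≡⟨ cong (λ a → (nat 3 + a) * (¾ * P (N₀ ℕ.+ j))) (nat-suc j) ⟩
      (nat 3 + (1ℚ + nat j)) * (¾ * P (N₀ ℕ.+ j))
        ≤⟨ ≤-by (0≤-* (nonNegative⁻¹ ¼) (0≤-* (0≤nat j) (0≤P (N₀ ℕ.+ j))))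
             (solve 2 (λ a p → (con (nat 3) :+ a) :* p
                := (con (nat 3) :+ (con 1ℚ :+ a)) :* (con ¾ :* p) :+ con ¼ :* (a :* p))
              refl (nat j) (P (N₀ ℕ.+ j))) ⟩
      (nat 3 + nat j) * P (N₀ ℕ.+ j)          ≡⟨ cong (_* P (N₀ ℕ.+ j)) (nat-+ 3 j) ⟨
      nat (3 ℕ.+ j) * P (N₀ ℕ.+ j)            ≤⟨ decay j ⟩
      nat 3 * P N₀                            ∎
      where open ≤-Reasoning

  oscillation : ∀ (x P : ℕ → ℚ) N₀ → (∀ n → 0ℚ ≤ P n) →
                (∀ n → N₀ ℕ.≤ n → P (suc n) ≤ ¾ * P n) →
                (∀ n → N₀ ℕ.≤ n → ∣ x (suc n) - x n ∣ ≤ ¼ * P n) →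
                ∀ {N m} → N₀ ℕ.≤ N → N ℕ.≤ m → ∣ x m - x N ∣ ≤ P N
  oscillation x P N₀ 0≤P shrink step {N} {m} N₀≤N N≤m =
    ≤-trans (≤-by (0≤P m) refl) (subst (λ m → ∣ x m - x N ∣ + P m ≤ P N) (ℕₚ.m+[n∸m]≡n N≤m) (go (m ℕ.∸ N)))
    where
    go : ∀ j → ∣ x (N ℕ.+ j) - x N ∣ + P (N ℕ.+ j) ≤ P N
    go zero rewrite ℕₚ.+-identityʳ N | +-inverseʳ (x N) = ≤-reflexive (+-identityˡ (P N))
    go (suc j) rewrite ℕₚ.+-suc N j = let n = N ℕ.+ j ; N₀≤n = ℕₚ.≤-trans N₀≤N (ℕₚ.m≤m+n N j) in begin
      ∣ x (suc n) - x N ∣ + P (suc n)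
        ≤⟨ +-mono-≤ (∣-∣-triangle (x (suc n)) (x n) (x N)) (shrink n N₀≤n) ⟩
      (∣ x (suc n) - x n ∣ + ∣ x n - x N ∣) + ¾ * P n
        ≤⟨ +-monoˡ-≤ (¾ * P n) (+-monoˡ-≤ ∣ x n - x N ∣ (step n N₀≤n)) ⟩
      (¼ * P n + ∣ x n - x N ∣) + ¾ * P n
        ≡⟨ solve 2 (λ p a → (con ¼ :* p :+ a) :+ con ¾ :* p := a :+ p) refl (P n) ∣ x n - x N ∣ ⟩
      ∣ x n - x N ∣ + P n
        ≤⟨ go j ⟩
      P N ∎
      where open ≤-Reasoning

  -- Convergence of the Taylor series.

  recip-antitone : ∀ j k → recip (j ℕ.+ k) ≤ recip j
  recip-antitone j k = begin
    recip (j ℕ.+ k)                                 ≡⟨ *-identityˡ _ ⟨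
    1ℚ * recip (j ℕ.+ k)                            ≡⟨ cong (_* recip (j ℕ.+ k)) (nat*recip j) ⟨
    (nat (suc j) * recip j) * recip (j ℕ.+ k)
      ≤⟨ *-monoʳ (0≤recip (j ℕ.+ k)) (*-monoʳ (0≤recip j) (nat-mono (ℕ.s≤s (ℕₚ.m≤m+n j k)))) ⟩
    (nat (suc (j ℕ.+ k)) * recip j) * recip (j ℕ.+ k)
      ≡⟨ solve 3 (λ a b c → (a :* b) :* c := b :* (a :* c)) refl (nat (suc (j ℕ.+ k))) (recip j) (recip (j ℕ.+ k)) ⟩
    recip j * (nat (suc (j ℕ.+ k)) * recip (j ℕ.+ k)) ≡⟨ cong (recip j *_) (nat*recip (j ℕ.+ k)) ⟩
    recip j * 1ℚ                                    ≡⟨ *-identityʳ _ ⟩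
    recip j                                         ∎
    where open ≤-Reasoning

  term-nonNeg : ∀ {x} → 0ℚ ≤ x → ∀ k → 0ℚ ≤ term x k
  term-nonNeg 0≤x zero    = nonNegative⁻¹ 1ℚ
  term-nonNeg 0≤x (suc k) = 0≤-* (term-nonNeg 0≤x k) (0≤-* 0≤x (0≤recip k))

  term-mono : ∀ {x y} → 0ℚ ≤ x → x ≤ y → ∀ k → term x k ≤ term y k
  term-mono 0≤x x≤y zero    = ≤-refl
  term-mono 0≤x x≤y (suc k) = *-mono-≤′ (term-nonNeg (≤-trans 0≤x x≤y) k) (0≤-* 0≤x (0≤recip k))
    (term-mono 0≤x x≤y k) (*-monoʳ (0≤recip k) x≤y)

  ∣term∣ : ∀ x k → ∣ term x k ∣ ≡ term ∣ x ∣ k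
  ∣term∣ x zero    = refl
  ∣term∣ x (suc k) = trans (∣p*q∣≡∣p∣*∣q∣ (term x k) (x * recip k))
    (cong₂ _*_ (∣term∣ x k) (trans (∣p*q∣≡∣p∣*∣q∣ x (recip k))
      (cong (∣ x ∣ *_) (0≤p⇒∣p∣≡p (0≤recip k)))))

  ∣weighted-term∣ : ∀ {c x M} k → ∣ c ∣ ≤ 1ℚ → ∣ x ∣ ≤ M → ∣ c * term x k ∣ ≤ term M k
  ∣weighted-term∣ {c} {x} {M} k ∣c∣≤1 ∣x∣≤M = begin
    ∣ c * term x k ∣      ≡⟨ ∣p*q∣≡∣p∣*∣q∣ c (term x k) ⟩
    ∣ c ∣ * ∣ term x k ∣  ≤⟨ *-monoʳ (0≤∣p∣ (term x k)) ∣c∣≤1 ⟩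
    1ℚ * ∣ term x k ∣     ≡⟨ *-identityˡ _ ⟩
    ∣ term x k ∣          ≡⟨ ∣term∣ x k ⟩
    term ∣ x ∣ k          ≤⟨ term-mono (0≤∣p∣ x) ∣x∣≤M k ⟩
    term M k              ∎
    where open ≤-Reasoning

  ∣sinCoeff∣≤1 : ∀ k → ∣ sinCoeff k ∣ ≤ 1ℚ
  ∣cosCoeff∣≤1 : ∀ k → ∣ cosCoeff k ∣ ≤ 1ℚ
  ∣sinCoeff∣≤1 zero    = nonNegative⁻¹ 1ℚ
  ∣sinCoeff∣≤1 (suc k) = ∣cosCoeff∣≤1 k
  ∣cosCoeff∣≤1 zero    = ≤-refl
  ∣cosCoeff∣≤1 (suc k) = subst (_≤ 1ℚ) (sym (∣-p∣≡∣p∣ (sinCoeff k))) (∣sinCoeff∣≤1 k)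

  step-diff : ∀ p q → (p + q) - p ≡ q
  step-diff = solve 2 (λ p q → (p :+ q) :- p := q) refl

  term-ratio : ∀ M k → nat 2 * M ≤ nat (suc k) → M * recip k ≤ ½
  term-ratio M k 2M≤1+k = begin
    M * recip k                        ≡⟨ solve 2 (λ m r → m :* r := con ½ :* ((con (nat 2) :* m) :* r)) refl M (recip k) ⟩
    ½ * ((nat 2 * M) * recip k)        ≤⟨ *-monoˡ (nonNegative⁻¹ ½) (*-monoʳ (0≤recip k) 2M≤1+k) ⟩
    ½ * (nat (suc k) * recip k)        ≡⟨ cong (½ *_) (nat*recip k) ⟩
    ½ * 1ℚ                             ≡⟨ *-identityʳ ½ ⟩
    ½                                  ∎
    where open ≤-Reasoning

  cauchy-term : ∀ {x : ℕ → ℚ} → Cauchy x → ∀ k → Cauchy (λ n → term (x n) k)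
  cauchy-term cx zero    = cauchy-const 1ℚ
  cauchy-term {x} cx (suc k) =
    cauchy-* {λ n → term (x n) k} {λ n → x n * recip k} (cauchy-term cx k)
      (cauchy-* {x} {λ _ → recip k} cx (cauchy-const (recip k)))

  cauchy-taylor : ∀ c {x : ℕ → ℚ} → Cauchy x → ∀ N → Cauchy (λ n → taylor c N (x n))
  cauchy-taylor c cx zero    = cauchy-const 0ℚ
  cauchy-taylor c {x} cx (suc N) =
    cauchy-+ {λ n → taylor c N (x n)} {λ n → c N * term (x n) N} (cauchy-taylor c cx N)
      (cauchy-* {λ _ → c N} {λ n → term (x n) N} (cauchy-const (c N)) (cauchy-term cx N))

  cauchy-series : ∀ c → (∀ k → ∣ c k ∣ ≤ 1ℚ) → ∀ {x} → Cauchy x → Cauchy (λ n → taylor c n (x n))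
  cauchy-series c ∣c∣≤1 {x} cx ε 0<ε =
    let (N , N₀≤N , PN<) = geometric P N₀ 0≤P shrink (½ * (½ * ε)) (0<half (0<half 0<ε))
        (K , close)      = cauchy-taylor c {x} cx N (½ * ε) (0<half 0<ε)
        tail : ∀ m → N ℕ.≤ m → ∣ taylor c m (x m) - taylor c N (x m) ∣ < ½ * (½ * ε)
        tail = λ m N≤m → ≤-<-trans
          (oscillation (λ n → taylor c n (x m)) P N₀ 0≤P shrink (step (x m) (∣x∣≤M m)) N₀≤N N≤m) PN<
    in N ℕ.⊔ K , λ m n N⊔K≤m N⊔K≤n →
      let N≤m = ℕₚ.m⊔n≤o⇒m≤o N K N⊔K≤m
          N≤n = ℕₚ.m⊔n≤o⇒m≤o N K N⊔K≤n
          K≤m = ℕₚ.m⊔n≤o⇒n≤o N K N⊔K≤m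
          K≤n = ℕₚ.m⊔n≤o⇒n≤o N K N⊔K≤n
          T = λ i j → taylor c i (x j)
      in begin-strict
        ∣ T m m - T n n ∣
          ≤⟨ ∣-∣-triangle (T m m) (T N m) (T n n) ⟩
        ∣ T m m - T N m ∣ + ∣ T N m - T n n ∣
          ≤⟨ +-monoʳ-≤ ∣ T m m - T N m ∣ (∣-∣-triangle (T N m) (T N n) (T n n)) ⟩
        ∣ T m m - T N m ∣ + (∣ T N m - T N n ∣ + ∣ T N n - T n n ∣)
          <⟨ +-mono-< (tail m N≤m) (+-mono-< (close m n K≤m K≤n)
               (subst (_< ½ * (½ * ε)) (∣-∣-sym (T n n) (T N n)) (tail n N≤n))) ⟩
        ½ * (½ * ε) + (½ * ε + ½ * (½ * ε))
          ≡⟨ solve 1 (λ e → con ½ :* (con ½ :* e) :+ (con ½ :* e :+ con ½ :* (con ½ :* e)) := e) refl ε ⟩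
        ε ∎
    where
    open ≤-Reasoning
    M = proj₁ (bounded {x} cx)
    0≤M = <⇒≤ (proj₁ (proj₂ (bounded {x} cx)))
    ∣x∣≤M = proj₂ (proj₂ (bounded {x} cx))
    N₀ = proj₁ (archimedean (nat 2 * M))
    P : ℕ → ℚ
    P k = nat 4 * term M k
    0≤P : ∀ k → 0ℚ ≤ P k
    0≤P k = 0≤-* (0≤nat 4) (term-nonNeg 0≤M k)
    shrink : ∀ k → N₀ ℕ.≤ k → P (suc k) ≤ ¾ * P k
    shrink k N₀≤k = begin
      nat 4 * (term M k * (M * recip k))  ≤⟨ *-monoˡ (0≤nat 4) (*-monoˡ (term-nonNeg 0≤M k)
          (term-ratio M k (≤-trans (proj₂ (archimedean (nat 2 * M))) (nat-mono (ℕₚ.m≤n⇒m≤1+n N₀≤k))))) ⟩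
      nat 4 * (term M k * ½)              ≤⟨ ≤-by (term-nonNeg 0≤M k)
          (solve 1 (λ t → con ¾ :* (con (nat 4) :* t) := con (nat 4) :* (t :* con ½) :+ t) refl (term M k)) ⟩
      ¾ * P k                             ∎
    step : ∀ z → ∣ z ∣ ≤ M → ∀ k → N₀ ℕ.≤ k → ∣ taylor c (suc k) z - taylor c k z ∣ ≤ ¼ * P k
    step z ∣z∣≤M k _ = begin
      ∣ taylor c (suc k) z - taylor c k z ∣  ≡⟨ cong ∣_∣ (step-diff (taylor c k z) (c k * term z k)) ⟩
      ∣ c k * term z k ∣                     ≤⟨ ∣weighted-term∣ k (∣c∣≤1 k) ∣z∣≤M ⟩
      term M k                               ≡⟨ solve 1 (λ t → t := con ¼ :* (con (nat 4) :* t)) refl (term M k) ⟩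
      ¼ * P k                                ∎

  -- Convergence of halfPiSeq: on [1, 17/10] the map x ↦ x + cosPoly n x has
  -- Lipschitz constant 3/4, by the alternating series estimate.

  alternating : ℕ → (ℕ → ℚ) → ℚ
  alternating m d = Σ< m (λ k → cosCoeff k * d k)

  alternating-peel : ∀ m d → alternating (2 ℕ.+ m) d ≡ d 0 - alternating m (λ k → d (2 ℕ.+ k))
  alternating-peel zero d =
    solve 2 (λ a b → (con 0ℚ :+ con 1ℚ :* a) :+ con 0ℚ :* b := a :- con 0ℚ) refl (d 0) (d 1)
  alternating-peel (suc m) d = trans (cong (_+ cosCoeff (2 ℕ.+ m) * d (2 ℕ.+ m)) (alternating-peel m d))
    (solve 4 (λ a s c e → (a :- s) :+ (:- c) :* e := a :- (s :+ c :* e)) refl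
      (d 0) (alternating m (λ k → d (2 ℕ.+ k))) (cosCoeff m) (d (2 ℕ.+ m)))

  alternating-diff : ∀ m d e → alternating m d - alternating m e ≡ alternating m (λ k → d k - e k)
  alternating-diff zero    d e = refl
  alternating-diff (suc m) d e = trans
    (solve 5 (λ s t c a b → (s :+ c :* a) :- (t :+ c :* b) := (s :- t) :+ c :* (a :- b)) refl
      (alternating m d) (alternating m e) (cosCoeff m) (d m) (e m))
    (cong (_+ cosCoeff m * (d m - e m)) (alternating-diff m d e))

  alternating-bounds : ∀ m d → (∀ k → 0ℚ ≤ d k) → (∀ k → d (2 ℕ.+ k) ≤ d k) →
                       0ℚ ≤ alternating m d × alternating m d ≤ d 0
  alternating-bounds zero          d 0≤d _   = ≤-refl , 0≤d 0
  alternating-bounds (suc zero)    d 0≤d _   =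
    subst (0ℚ ≤_) eq (0≤d 0) , ≤-reflexive (sym eq)
    where eq = solve 1 (λ a → a := con 0ℚ :+ con 1ℚ :* a) refl (d 0)
  alternating-bounds (suc (suc m)) d 0≤d dec =
    let (0≤S , S≤d₂) = alternating-bounds m (λ k → d (2 ℕ.+ k)) (λ k → 0≤d (2 ℕ.+ k)) (λ k → dec (2 ℕ.+ k))
        eq = alternating-peel m d
    in subst (0ℚ ≤_) (sym eq) (0≤-∸ (≤-trans S≤d₂ (dec 0))) ,
       subst (_≤ d 0) (sym eq) (≤-by 0≤S
         (solve 2 (λ a s → a := (a :- s) :+ s) refl (d 0) (alternating m (λ k → d (2 ℕ.+ k)))))

  ℚ-lit : ∀ {p q} → ℚ._≤ᵇ_ p q ≡ true → p ≤ q
  ℚ-lit eq = ≤ᵇ⇒≤ (subst T (sym eq) _)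

  cosPoly-diff : ∀ m {x y} → 0ℚ ≤ x → x ≤ y → y ≤ nat 2 →
    let S  = cosPoly (4 ℕ.+ m) x - cosPoly (4 ℕ.+ m) y
        D₂ = ½ * (y * y - x * x)
        D₄ = (ℤ.+ 1 / 24) * (y * y * (y * y) - x * x * (x * x))
    in D₂ - D₄ ≤ S × S ≤ D₂
  cosPoly-diff m {x} {y} 0≤x x≤y y≤2 =
    subst₂ _≤_ (cong₂ _-_ d₀ d₂) (sym S≡) (≤-by (0≤-∸ (proj₂ bounds)) lower) ,
    subst₂ _≤_ (sym S≡) d₀ (≤-by (proj₁ bounds) upper)
    where
    0≤y = ≤-trans 0≤x x≤y
    D D″ : ℕ → ℚ
    D k = term y (2 ℕ.+ k) - term x (2 ℕ.+ k)
    D″ k = D (2 ℕ.+ k)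
    0≤D : ∀ k → 0ℚ ≤ D k
    0≤D k = 0≤-∸ (term-mono 0≤x x≤y (2 ℕ.+ k))
    x²+y²≤8 : x * x + y * y ≤ nat 8
    x²+y²≤8 = +-mono-≤ (*-mono-≤′ (0≤nat 2) 0≤x (≤-trans x≤y y≤2) (≤-trans x≤y y≤2))
                       (*-mono-≤′ (0≤nat 2) 0≤y y≤2 y≤2)
    dec : ∀ k → D (2 ℕ.+ k) ≤ D k
    dec k = ≤-by
      (0≤-+ (0≤-* (0≤D k) (0≤-∸ σ[x²+y²]≤1))
            (0≤-* (0≤-* (0≤-* (0≤recip k) (0≤recip (1 ℕ.+ k))) (0≤-* (0≤recip (2 ℕ.+ k)) (0≤recip (3 ℕ.+ k))))
                  (0≤-* (0≤-* (0≤x² x) (0≤x² y)) (0≤-∸ (term-mono 0≤x x≤y k)))))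
      (solve 8 (λ a b x y r₀ r₁ r₂ r₃ →
        let a₂ = (a :* (y :* r₀)) :* (y :* r₁)
            b₂ = (b :* (x :* r₀)) :* (x :* r₁)
            a₄ = (a₂ :* (y :* r₂)) :* (y :* r₃)
            b₄ = (b₂ :* (x :* r₂)) :* (x :* r₃)
        in a₂ :- b₂ := (a₄ :- b₄) :+ ((a₂ :- b₂) :* (con 1ℚ :- (r₂ :* r₃) :* (x :* x :+ y :* y))
             :+ ((r₀ :* r₁) :* (r₂ :* r₃)) :* (((x :* x) :* (y :* y)) :* (a :- b))))
        refl (term y k) (term x k) x y (recip k) (recip (1 ℕ.+ k)) (recip (2 ℕ.+ k)) (recip (3 ℕ.+ k)))
      where
      σ[x²+y²]≤1 : (recip (2 ℕ.+ k) * recip (3 ℕ.+ k)) * (x * x + y * y) ≤ 1ℚ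
      σ[x²+y²]≤1 = ≤-trans
        (*-mono-≤′ (nonNegative⁻¹ (recip 2 * recip 3)) (0≤-+ (0≤x² x) (0≤x² y))
          (*-mono-≤′ (0≤recip 2) (0≤recip (3 ℕ.+ k)) (recip-antitone 2 k) (recip-antitone 3 k))
          x²+y²≤8)
        (ℚ-lit refl)
    bounds = alternating-bounds m D″ (λ k → 0≤D (2 ℕ.+ k)) (λ k → dec (2 ℕ.+ k))
    S≡ : cosPoly (4 ℕ.+ m) x - cosPoly (4 ℕ.+ m) y ≡ D 0 - alternating m D″
    S≡ = trans (cong₂ _-_ (alternating-peel (2 ℕ.+ m) (term x)) (alternating-peel (2 ℕ.+ m) (term y)))
      (trans (solve 3 (λ a s t → (a :- s) :- (a :- t) := t :- s) refl 1ℚ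
               (alternating (2 ℕ.+ m) (λ k → term x (2 ℕ.+ k))) (alternating (2 ℕ.+ m) (λ k → term y (2 ℕ.+ k))))
        (trans (alternating-diff (2 ℕ.+ m) (λ k → term y (2 ℕ.+ k)) (λ k → term x (2 ℕ.+ k)))
          (alternating-peel m D)))
    lower = solve 3 (λ a b s → a :- s := (a :- b) :+ (b :- s)) refl (D 0) (D 2) (alternating m D″)
    upper = solve 2 (λ a s → a := (a :- s) :+ s) refl (D 0) (alternating m D″)
    d₀ : D 0 ≡ ½ * (y * y - x * x)
    d₀ = solve 2 (λ x y →
           let t₂ = λ z → (con 1ℚ :* (z :* con (recip 0))) :* (z :* con (recip 1))
           in t₂ y :- t₂ x := con ½ :* (y :* y :- x :* x)) refl x y
    d₂ : D 2 ≡ (ℤ.+ 1 / 24) * (y * y * (y * y) - x * x * (x * x))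
    d₂ = solve 2 (λ x y →
           let t₄ = λ z → (((con 1ℚ :* (z :* con (recip 0))) :* (z :* con (recip 1)))
                            :* (z :* con (recip 2))) :* (z :* con (recip 3))
           in t₄ y :- t₄ x := con (ℤ.+ 1 / 24) :* (y :* y :* (y :* y) :- x :* x :* (x :* x))) refl x y

  Φ : ℕ → ℚ → ℚ
  Φ n x = x + cosPoly n x

  1⁷⁄₁₀ : ℚ
  1⁷⁄₁₀ = ℤ.+ 17 / 10

  InI : ℚ → Set
  InI x = 1ℚ ≤ x × x ≤ 1⁷⁄₁₀

  0≤InI : ∀ {x} → InI x → 0ℚ ≤ x
  0≤InI (1≤x , _) = ≤-trans (nonNegative⁻¹ 1ℚ) 1≤x

  InI≤2 : ∀ {x} → InI x → x ≤ nat 2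
  InI≤2 (_ , x≤) = ≤-trans x≤ (ℚ-lit refl)

  x²≤3 : ∀ {x} → InI x → x * x ≤ nat 3
  x²≤3 i@(_ , x≤) = ≤-trans (*-mono-≤′ (nonNegative⁻¹ 1⁷⁄₁₀) (0≤InI i) x≤ x≤) (ℚ-lit refl)

  cosPoly-0 : ∀ n → cosPoly (suc n) 0ℚ ≡ 1ℚ
  cosPoly-0 zero    = refl
  cosPoly-0 (suc n) = trans (cong (_+ cosCoeff (suc n) * term 0ℚ (suc n)) (cosPoly-0 n))
    (solve 3 (λ c t r → con 1ℚ :+ c :* (t :* (con 0ℚ :* r)) := con 1ℚ) refl
      (cosCoeff (suc n)) (term 0ℚ n) (recip n))

  Φ-InI : ∀ m {y} → InI y → InI (Φ (4 ℕ.+ m) y)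
  Φ-InI m {y} i@(1≤y , y≤1⁷⁄₁₀) =
    ≤-by (0≤-+ (0≤-∸ S≤) (0≤-* (nonNegative⁻¹ ½) (0≤-* (0≤InI i) (0≤-∸ (InI≤2 i)))))
      (trans (cong (y +_) C≡) (solve 2 (λ y s →
        y :+ (con 1ℚ :- s) := con 1ℚ :+ ((con ½ :* (y :* y :- con 0ℚ) :- s)
          :+ con ½ :* (y :* (con (nat 2) :- y)))) refl y S)) ,
    ≤-by (0≤-+ (0≤-+ (0≤-∸ ≤S) (0≤-* (nonNegative⁻¹ (ℤ.+ 1 / 24)) (0≤-* (0≤x² y) (0≤-∸ (x²≤3 i)))))
               (0≤-+ (0≤-* (nonNegative⁻¹ (ℤ.+ 3 / 8)) (0≤x² (y - ℤ.+ 4 / 3))) (nonNegative⁻¹ (ℤ.+ 1 / 30))))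
      (trans (solve 2 (λ y s →
        con 1⁷⁄₁₀ := (y :+ (con 1ℚ :- s)) :+
          (((s :- (con ½ :* (y :* y :- con 0ℚ) :- con (ℤ.+ 1 / 24) :* (y :* y :* (y :* y) :- con 0ℚ)))
            :+ con (ℤ.+ 1 / 24) :* ((y :* y) :* (con (nat 3) :- y :* y)))
           :+ (con (ℤ.+ 3 / 8) :* ((y :- con (ℤ.+ 4 / 3)) :* (y :- con (ℤ.+ 4 / 3))) :+ con (ℤ.+ 1 / 30))))
        refl y S) (cong (λ c → (y + c) + gap) (sym C≡)))
    where
    S = 1ℚ - cosPoly (4 ℕ.+ m) y
    C≡ : cosPoly (4 ℕ.+ m) y ≡ 1ℚ - S
    C≡ = solve 1 (λ c → c := con 1ℚ :- (con 1ℚ :- c)) refl (cosPoly (4 ℕ.+ m) y)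
    estimate = cosPoly-diff m ≤-refl (0≤InI i) (InI≤2 i)
    eq : cosPoly (4 ℕ.+ m) 0ℚ - cosPoly (4 ℕ.+ m) y ≡ S
    eq = cong (_- cosPoly (4 ℕ.+ m) y) (cosPoly-0 (3 ℕ.+ m))
    ≤S : ½ * (y * y - 0ℚ) - (ℤ.+ 1 / 24) * (y * y * (y * y) - 0ℚ) ≤ S
    ≤S = subst (½ * (y * y - 0ℚ) - (ℤ.+ 1 / 24) * (y * y * (y * y) - 0ℚ) ≤_) eq (proj₁ estimate)
    S≤ : S ≤ ½ * (y * y - 0ℚ)
    S≤ = subst (_≤ ½ * (y * y - 0ℚ)) eq (proj₂ estimate)
    gap = ((S - (½ * (y * y - 0ℚ) - (ℤ.+ 1 / 24) * (y * y * (y * y) - 0ℚ)))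
            + (ℤ.+ 1 / 24) * ((y * y) * (nat 3 - y * y)))
           + ((ℤ.+ 3 / 8) * ((y - ℤ.+ 4 / 3) * (y - ℤ.+ 4 / 3)) + ℤ.+ 1 / 30)

  Φ-lipschitz-≤ : ∀ m {x y} → InI x → InI y → x ≤ y →
                  ∣ Φ (4 ℕ.+ m) y - Φ (4 ℕ.+ m) x ∣ ≤ ¾ * ∣ y - x ∣
  Φ-lipschitz-≤ m {x} {y} i@(1≤x , x≤) j@(1≤y , y≤) x≤y =
    subst (λ d → ∣ Φ (4 ℕ.+ m) y - Φ (4 ℕ.+ m) x ∣ ≤ ¾ * d) (sym (0≤p⇒∣p∣≡p 0≤y-x))
      (∣∣-bound
        (≤-by (0≤-+ (0≤-∸ (proj₁ estimate)) (0≤-* 0≤y-x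
                (0≤-+ (0≤-+ (nonNegative⁻¹ ¼) 0≤q) (0≤-* 0≤p (0≤-+ (nonNegative⁻¹ ¼) (0≤-* (nonNegative⁻¹ ½) 0≤q))))))
          (solve 4 (λ x y c e →
             let p = (x :+ y) :- con (nat 2)
                 q = con (nat 6) :- (x :* x :+ y :* y)
             in con ¾ :* (y :- x) := ((y :+ e) :- (x :+ c)) :+
               (((c :- e) :- (con ½ :* (y :* y :- x :* x)
                                :- con (ℤ.+ 1 / 24) :* (y :* y :* (y :* y) :- x :* x :* (x :* x))))
               :+ (y :- x) :* ((con ¼ :+ con (ℤ.+ 1 / 12) :* q)
                    :+ p :* (con ¼ :+ con ½ :* (con (ℤ.+ 1 / 12) :* q)))))
            refl x y C E))
        (≤-by (0≤-+ (0≤-∸ (proj₂ estimate)) (0≤-* 0≤y-x (0≤-* (nonNegative⁻¹ ½) 0≤r)))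
          (solve 4 (λ x y c e →
             con ¾ :* (y :- x) := (:- ((y :+ e) :- (x :+ c))) :+
               ((con ½ :* (y :* y :- x :* x) :- (c :- e))
               :+ (y :- x) :* (con ½ :* (con (ℤ.+ 7 / 2) :- (x :+ y)))))
            refl x y C E)))
    where
    C = cosPoly (4 ℕ.+ m) x
    E = cosPoly (4 ℕ.+ m) y
    estimate = cosPoly-diff m (0≤InI i) x≤y (InI≤2 j)
    0≤y-x = 0≤-∸ x≤y
    0≤p : 0ℚ ≤ (x + y) - nat 2
    0≤p = 0≤-∸ (+-mono-≤ 1≤x 1≤y)
    0≤q : 0ℚ ≤ (ℤ.+ 1 / 12) * (nat 6 - (x * x + y * y))
    0≤q = 0≤-* (nonNegative⁻¹ (ℤ.+ 1 / 12)) (0≤-∸ (+-mono-≤ (x²≤3 i) (x²≤3 j)))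
    0≤r : 0ℚ ≤ ℤ.+ 7 / 2 - (x + y)
    0≤r = 0≤-∸ (≤-trans (+-mono-≤ x≤ y≤) (ℚ-lit {1⁷⁄₁₀ + 1⁷⁄₁₀} {ℤ.+ 7 / 2} refl))

  Φ-lipschitz : ∀ m {x y} → InI x → InI y → ∣ Φ (4 ℕ.+ m) y - Φ (4 ℕ.+ m) x ∣ ≤ ¾ * ∣ y - x ∣
  Φ-lipschitz m {x} {y} i j with ≤-total x y
  ... | inj₁ x≤y = Φ-lipschitz-≤ m i j x≤y
  ... | inj₂ y≤x = subst₂ (λ a b → a ≤ ¾ * b)
    (∣-∣-sym (Φ (4 ℕ.+ m) x) (Φ (4 ℕ.+ m) y)) (∣-∣-sym x y) (Φ-lipschitz-≤ m j i y≤x)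

  halfPiSeq-InI : ∀ m → InI (halfPiSeq (5 ℕ.+ m))
  halfPiSeq-InI zero    = ℚ-lit refl , ℚ-lit refl
  halfPiSeq-InI (suc m) = Φ-InI (suc m) (halfPiSeq-InI m)

  cauchy-halfPiSeq : Cauchy halfPiSeq
  cauchy-halfPiSeq = cauchy-from {halfPiSeq} λ ε 0<ε →
    let (N , 5≤N , PN<ε) = geometric P 5 0≤P shrink ε 0<ε
    in N , λ m N≤m → ≤-<-trans (oscillation halfPiSeq P 5 0≤P shrink step 5≤N N≤m) PN<ε
    where
    open ≤-Reasoning
    δ P : ℕ → ℚ
    δ n = ∣ halfPiSeq (suc n) - halfPiSeq n ∣
    P n = nat 4 * δ n + nat 12 * term (nat 2) n
    0≤t : ∀ n → 0ℚ ≤ term (nat 2) n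
    0≤t = term-nonNeg (0≤nat 2)
    0≤P : ∀ n → 0ℚ ≤ P n
    0≤P n = 0≤-+ (0≤-* (0≤nat 4) (0≤∣p∣ (halfPiSeq (suc n) - halfPiSeq n))) (0≤-* (0≤nat 12) (0≤t n))
    step : ∀ n → 5 ℕ.≤ n → δ n ≤ ¼ * P n
    step n _ = ≤-by (0≤-* (0≤nat 3) (0≤t n))
      (solve 2 (λ d t → con ¼ :* (con (nat 4) :* d :+ con (nat 12) :* t) := d :+ con (nat 3) :* t)
        refl (δ n) (term (nat 2) n))
    δ-suc : ∀ m → let n = 5 ℕ.+ m in δ (suc n) ≤ ¾ * δ n + term (nat 2) n
    δ-suc m = begin
      ∣ (x″ + (cosPoly n x″ + c)) - (x′ + cosPoly n x′) ∣
        ≡⟨ cong ∣_∣ (solve 5 (λ x y a b c → (y :+ (b :+ c)) :- (x :+ a) := ((y :+ b) :- (x :+ a)) :+ c)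
             refl x′ x″ (cosPoly n x′) (cosPoly n x″) c) ⟩
      ∣ (Φ n x″ - Φ n x′) + c ∣
        ≤⟨ ∣p+q∣≤∣p∣+∣q∣ (Φ n x″ - Φ n x′) c ⟩
      ∣ Φ n x″ - Φ n x′ ∣ + ∣ c ∣
        ≤⟨ +-mono-≤ (Φ-lipschitz (suc m) i′ i″)
             (∣weighted-term∣ n (∣cosCoeff∣≤1 n)
               (subst (_≤ nat 2) (sym (0≤p⇒∣p∣≡p (0≤InI i″))) (InI≤2 i″))) ⟩
      ¾ * δ n + term (nat 2) n ∎
      where
      n = 5 ℕ.+ m
      x′ = halfPiSeq n
      x″ = halfPiSeq (suc n)
      c = cosCoeff n * term x″ n
      i′ = halfPiSeq-InI m
      i″ = halfPiSeq-InI (suc m)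
    term-suc : ∀ m → let n = 5 ℕ.+ m in term (nat 2) (suc n) ≤ term (nat 2) n * (ℤ.+ 1 / 3)
    term-suc m = *-monoˡ (0≤t (5 ℕ.+ m)) (*-monoˡ (0≤nat 2) (recip-antitone 5 m))
    shrink : ∀ n → 5 ℕ.≤ n → P (suc n) ≤ ¾ * P n
    shrink n 5≤n = subst (λ n → P (suc n) ≤ ¾ * P n) (ℕₚ.m+[n∸m]≡n 5≤n) (go (n ℕ.∸ 5))
      where
      go : ∀ m → P (6 ℕ.+ m) ≤ ¾ * P (5 ℕ.+ m)
      go m = ≤-trans
        (+-mono-≤ (*-monoˡ (0≤nat 4) (δ-suc m)) (*-monoˡ (0≤nat 12) (term-suc m)))
        (≤-by (0≤t (5 ℕ.+ m))
          (solve 2 (λ d t → con ¾ :* (con (nat 4) :* d :+ con (nat 12) :* t)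
              := (con (nat 4) :* (con ¾ :* d :+ t) :+ con (nat 12) :* (t :* con (ℤ.+ 1 / 3))) :+ t)
            refl (δ (5 ℕ.+ m)) (term (nat 2) (5 ℕ.+ m))))

open RationalSequences using (Cauchy; sinPoly; cosPoly; halfPiSeq)

record ℝ : Set where
  constructor mkℝ
  field
    approx : ℕ → ℚ
    cauchy : Cauchy approx

open ℝ public

infix  4 _≈_ _<_
infix  8 -_
infixl 6 _+_ _-_
infixl 7 _*_

_≈_ : ℝ → ℝ → Set
x ≈ y = ∀ ε → 0ℚ ℚ.< ε → ∃[ N ] (∀ n → N ℕ.≤ n → ℚ.∣ approx x n ℚ.- approx y n ∣ ℚ.< ε)

_<_ : ℝ → ℝ → Set
x < y = ∃[ ε ] (0ℚ ℚ.< ε × ∃[ N ] (∀ n → N ℕ.≤ n → approx x n ℚ.+ ε ℚ.< approx y n))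

fromℚ : ℚ → ℝ
fromℚ q = mkℝ (λ _ → q) (RationalSequences.cauchy-const q)

_+_ : ℝ → ℝ → ℝ
mkℝ x cx + mkℝ y cy = mkℝ (λ n → x n ℚ.+ y n) (RationalSequences.cauchy-+ {x} {y} cx cy)

-_ : ℝ → ℝ
- mkℝ x cx = mkℝ (λ n → ℚ.- x n) (RationalSequences.cauchy-neg {x} cx)

_-_ : ℝ → ℝ → ℝ
x - y = x + (- y)

_*_ : ℝ → ℝ → ℝ
mkℝ x cx * mkℝ y cy = mkℝ (λ n → x n ℚ.* y n) (RationalSequences.cauchy-* {x} {y} cx cy)

0ℝ : ℝ
0ℝ = fromℚ 0ℚ

-- The n-th approximation is the sum of the terms of degree < n of the Taylor
-- series at 0, evaluated at the n-th approximation of the argument.  Since the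
-- series converges uniformly on bounded sets, this represents its sum.

sin cos : ℝ → ℝ
sin (mkℝ x cx) = mkℝ (λ n → sinPoly n (x n))
  (RationalSequences.cauchy-series RationalSequences.sinCoeff RationalSequences.∣sinCoeff∣≤1 {x} cx)
cos (mkℝ x cx) = mkℝ (λ n → cosPoly n (x n))
  (RationalSequences.cauchy-series RationalSequences.cosCoeff RationalSequences.∣cosCoeff∣≤1 {x} cx)

-- π/2 is the zero of cos in (0,2); see 0<π/2<2 and cos[π/2]≈0.

π/2 π : ℝ
π/2 = mkℝ halfPiSeq RationalSequences.cauchy-halfPiSeq
π   = π/2 + π/2

0<π/2<2 : 0ℝ < π/2 × π/2 < fromℚ (ℤ.+ 2 ℚ./ 1)
0<π/2<2 =
  (ε , 0<ε , 5 , λ n 5≤n → ℚₚ.<-≤-trans 0+ε<1 (proj₁ (inI n 5≤n))) ,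
  (ε , 0<ε , 5 , λ n 5≤n → ℚₚ.≤-<-trans (ℚₚ.+-monoˡ-≤ ε (proj₂ (inI n 5≤n))) 17/10+ε<2)
  where
  ε = ℤ.+ 1 ℚ./ 20
  0<ε = ℚₚ.positive⁻¹ ε
  0+ε<1 : 0ℚ ℚ.+ ε ℚ.< 1ℚ
  0+ε<1 = from-yes (0ℚ ℚ.+ ε ℚₚ.<? 1ℚ)
  17/10+ε<2 : ℤ.+ 17 ℚ./ 10 ℚ.+ ε ℚ.< ℤ.+ 2 ℚ./ 1
  17/10+ε<2 = from-yes (ℤ.+ 17 ℚ./ 10 ℚ.+ ε ℚₚ.<? ℤ.+ 2 ℚ./ 1)
  inI : ∀ n → 5 ℕ.≤ n → RationalSequences.InI (halfPiSeq n)
  inI n 5≤n = subst (λ n → RationalSequences.InI (halfPiSeq n)) (ℕₚ.m+[n∸m]≡n 5≤n)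
    (RationalSequences.halfPiSeq-InI (n ℕ.∸ 5))

cos[π/2]≈0 : cos π/2 ≈ 0ℝ
cos[π/2]≈0 ε 0<ε =
  let (N , close) = RationalSequences.cauchy-halfPiSeq ε 0<ε in
  N , λ n N≤n → subst (λ d → ℚ.∣ d ∣ ℚ.< ε)
    (trans (RationalSequences.step-diff (halfPiSeq n) (cosPoly n (halfPiSeq n)))
      (sym (ℚₚ.+-identityʳ (cosPoly n (halfPiSeq n)))))
    (close (suc n) n (ℕₚ.m≤n⇒m≤1+n N≤n) N≤n)

-- Angles are in degrees.

180° : ℝ
180° = fromℚ (ℤ.+ 180 ℚ./ 1)

sin° : ℝ → ℝ
sin° α = sin (α * (π * fromℚ (ℤ.+ 1 ℚ./ 180)))

-- Line i of the family is the set of points (p , q) with p cos θᵢ + q sin θᵢ = rᵢ.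

module _ {n : ℕ} (θ : Fin n → ℝ) where

  s : Fin n → Fin n → ℝ
  s i j = sin° (θ j - θ i)

  Ordered : Fin n → Fin n → Fin n → Set
  Ordered i j k = 0ℝ < θ i × θ i < θ j × θ j < θ k × θ k < 180°

module _ {n : ℕ} (r θ : Fin n → ℝ) where

  -- The formulas presuppose θᵢ < θⱼ < θₖ, which Ordered supplies.
  PositivelyOriented NegativelyOriented : Fin n → Fin n → Fin n → Set
  PositivelyOriented i j k = 0ℝ < r i * s θ j k - r j * s θ i k + r k * s θ i j
  NegativelyOriented i j k = 0ℝ < - r i * s θ j k + r j * s θ i k - r k * s θ i j

pattern ℓ₁  = zero
pattern ℓ₂  = suc ℓ₁
pattern ℓ₃  = suc ℓ₂
pattern ℓ₄  = suc ℓ₃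
pattern ℓ₅  = suc ℓ₄
pattern ℓ₆  = suc ℓ₅
pattern ℓ₇  = suc ℓ₆
pattern ℓ₈  = suc ℓ₇
pattern ℓ₉  = suc ℓ₈
pattern ℓ₁₀ = suc ℓ₉

-- Translating the origin to the intersection of lines 1 and 7 replaces every rᵢ
-- by hᵢ / s₁₇, where hᵢ is the negatively oriented bracket of (1,i,7); in
-- particular r₁ and r₇ become 0.  The nine hypotheses are then linear in
-- h₂, h₃, h₄, h₅, h₆, h₈, h₉, h₁₀.  Eliminating h₂, h₆, h₈, h₉, h₁₀ with positive
-- coefficients, and h₃, h₄ by their signs, leaves the claimed expression times
-- -h₅, and -h₅ > 0 since (1,5,7) is positively oriented.
--
-- Two facts on the sine are needed.  The subtraction formula, which makes
-- (i,j) ↦ sᵢⱼ a 2×2 determinant, comes from the Cauchy product of Taylor series;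
-- positivity on (0°,180°) from sin 2h = 2 sin h cos h and estimates of the Taylor
-- polynomials on (0,π/2).

module Submission where

open import Data.Fin.Base using (Fin)
open import Data.Integer.Base as ℤ using ()
open import Data.Nat.Base as ℕ using (ℕ; zero; suc)
import Data.Nat.Properties as ℕₚ
open import Data.Product.Base using (∃-syntax; _×_; _,_; proj₁; proj₂)
open import Data.Rational as ℚ using (ℚ; 0ℚ; 1ℚ; ½)
import Data.Rational.Properties as ℚₚ
open import Data.Rational.Solver using (module +-*-Solver)
open import Data.Sum.Base using (inj₁; inj₂)
open import Function.Base using (_∘_)
open import Relation.Binary.PropositionalEquality
  using (_≡_; refl; sym; trans; cong; cong₂; subst; subst₂; module ≡-Reasoning)
open import Defs using (module RationalSequences)
open +-*-Solver using (solve; _:+_; _:*_; _:-_; :-_; _:=_; con)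

module TaylorPolynomials where

  open RationalSequences
  open import Data.Rational using (_+_; _*_; _-_; -_; ∣_∣; _≤_; _<_; _/_)
  open ℚₚ

  -- Finite sums of rationals

  p≤∣p∣ : ∀ p → p ≤ ∣ p ∣
  p≤∣p∣ p with ≤-total 0ℚ p
  ... | inj₁ 0≤p = ≤-reflexive (sym (0≤p⇒∣p∣≡p 0≤p))
  ... | inj₂ p≤0 = ≤-trans p≤0 (0≤∣p∣ p)

  Σ<-cong : ∀ n {f g : ℕ → ℚ} → (∀ k → f k ≡ g k) → Σ< n f ≡ Σ< n g
  Σ<-cong zero    f≗g = refl
  Σ<-cong (suc n) f≗g = cong₂ _+_ (Σ<-cong n f≗g) (f≗g n)

  Σ<-+ : ∀ n f g → Σ< n (λ k → f k + g k) ≡ Σ< n f + Σ< n g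
  Σ<-+ zero    f g = refl
  Σ<-+ (suc n) f g = trans (cong (_+ (f n + g n)) (Σ<-+ n f g))
    (solve 4 (λ p q a b → (p :+ q) :+ (a :+ b) := (p :+ a) :+ (q :+ b)) refl
      (Σ< n f) (Σ< n g) (f n) (g n))

  Σ<-neg : ∀ n f → Σ< n (λ k → - f k) ≡ - Σ< n f
  Σ<-neg zero    f = refl
  Σ<-neg (suc n) f = trans (cong (_+ (- f n)) (Σ<-neg n f)) (sym (neg-distrib-+ (Σ< n f) (f n)))

  Σ<-head : ∀ n f → Σ< (suc n) f ≡ f 0 + Σ< n (f ∘ suc)
  Σ<-head zero    f = +-comm 0ℚ (f 0)
  Σ<-head (suc n) f = trans (cong (_+ f (suc n)) (Σ<-head n f)) (+-assoc (f 0) _ _)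

  Σ<-mono : ∀ {f} → (∀ k → 0ℚ ≤ f k) → ∀ {m n} → m ℕ.≤ n → Σ< m f ≤ Σ< n f
  Σ<-mono 0≤f {n = n} ℕ.z≤n = Σ<-nonNeg n 0≤f
  Σ<-mono {f} 0≤f {suc m} {suc n} (ℕ.s≤s m≤n) =
    subst₂ _≤_ (sym (Σ<-head m f)) (sym (Σ<-head n f))
      (+-monoʳ-≤ (f 0) (Σ<-mono (λ k → 0≤f (suc k)) m≤n))

  -- Cauchy products of coefficient sequences

  -- triangle n a b and diagonal n a b are the sums of aᵢ bⱼ over i + j < n and
  -- over i + j = n.

  triangle diagonal : ℕ → (ℕ → ℚ) → (ℕ → ℚ) → ℚ
  triangle zero    a b = 0ℚ
  triangle (suc n) a b = a 0 * Σ< (suc n) b + triangle n (a ∘ suc) b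
  diagonal zero    a b = a 0 * b 0
  diagonal (suc n) a b = a 0 * b (suc n) + diagonal n (a ∘ suc) b

  triangle-suc : ∀ n a b → triangle (suc n) a b ≡ triangle n a b + diagonal n a b
  triangle-suc zero    a b =
    solve 2 (λ a b → a :* (con 0ℚ :+ b) :+ con 0ℚ := con 0ℚ :+ a :* b) refl (a 0) (b 0)
  triangle-suc (suc n) a b = trans
    (cong (a 0 * (Σ< (suc n) b + b (suc n)) +_) (triangle-suc n (a ∘ suc) b))
    (solve 5 (λ a s b t d → a :* (s :+ b) :+ (t :+ d) := (a :* s :+ t) :+ (a :* b :+ d)) refl
      (a 0) (Σ< (suc n) b) (b (suc n)) (triangle n (a ∘ suc) b) (diagonal n (a ∘ suc) b))

  triangle≡Σdiagonal : ∀ n a b → triangle n a b ≡ Σ< n (λ k → diagonal k a b)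
  triangle≡Σdiagonal zero    a b = refl
  triangle≡Σdiagonal (suc n) a b =
    trans (triangle-suc n a b) (cong (_+ diagonal n a b) (triangle≡Σdiagonal n a b))

  diagonal-cong : ∀ n {a a′ b b′ : ℕ → ℚ} → (∀ k → a k ≡ a′ k) → (∀ k → b k ≡ b′ k) →
                  diagonal n a b ≡ diagonal n a′ b′
  diagonal-cong zero    a≗ b≗ = cong₂ _*_ (a≗ 0) (b≗ 0)
  diagonal-cong (suc n) a≗ b≗ =
    cong₂ _+_ (cong₂ _*_ (a≗ 0) (b≗ (suc n))) (diagonal-cong n (λ k → a≗ (suc k)) b≗)

  diagonal-+ˡ : ∀ n a a′ b → diagonal n (λ k → a k + a′ k) b ≡ diagonal n a b + diagonal n a′ b
  diagonal-+ˡ zero    a a′ b = *-distribʳ-+ (b 0) (a 0) (a′ 0)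
  diagonal-+ˡ (suc n) a a′ b = trans
    (cong ((a 0 + a′ 0) * b (suc n) +_) (diagonal-+ˡ n (a ∘ suc) (a′ ∘ suc) b))
    (solve 5 (λ x y z d e → (x :+ y) :* z :+ (d :+ e) := (x :* z :+ d) :+ (y :* z :+ e)) refl
      (a 0) (a′ 0) (b (suc n)) (diagonal n (a ∘ suc) b) (diagonal n (a′ ∘ suc) b))

  diagonal-*ˡ : ∀ n c a b → diagonal n (λ k → c * a k) b ≡ c * diagonal n a b
  diagonal-*ˡ zero    c a b = *-assoc c (a 0) (b 0)
  diagonal-*ˡ (suc n) c a b = trans (cong (c * a 0 * b (suc n) +_) (diagonal-*ˡ n c (a ∘ suc) b))
    (solve 4 (λ c a b d → c :* a :* b :+ c :* d := c :* (a :* b :+ d)) refl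
      c (a 0) (b (suc n)) (diagonal n (a ∘ suc) b))

  diagonal-*ʳ : ∀ n c a b → diagonal n a (λ k → c * b k) ≡ c * diagonal n a b
  diagonal-*ʳ zero    c a b = solve 3 (λ c a b → a :* (c :* b) := c :* (a :* b)) refl c (a 0) (b 0)
  diagonal-*ʳ (suc n) c a b = trans (cong (a 0 * (c * b (suc n)) +_) (diagonal-*ʳ n c (a ∘ suc) b))
    (solve 4 (λ c a b d → a :* (c :* b) :+ c :* d := c :* (a :* b :+ d)) refl
      c (a 0) (b (suc n)) (diagonal n (a ∘ suc) b))

  -- Addition and parity formulas as identities of formal power series

  -- The coefficients of the derivative of the power series Σ aₖ tᵏ.
  ∂ : (ℕ → ℚ) → ℕ → ℚ
  ∂ a k = nat (suc k) * a (suc k)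

  -- Induction on n peels off the constant coefficient of the first factor. Of the factor n + 2 the
  -- part `ν` feeds the induction hypothesis for `a ∘ suc`; the remaining copy of `d` completes
  -- `∂ (a ∘ suc)` to the shift of `∂ a`, which is `∂-shift`.
  leibniz : ∀ n a b → ∂ (λ k → diagonal k a b) n ≡ diagonal n (∂ a) b + diagonal n a (∂ b)
  leibniz zero a b =
    solve 4 (λ a₀ a₁ b₀ b₁ → con 1ℚ :* (a₀ :* b₁ :+ a₁ :* b₀)
      := con 1ℚ :* a₁ :* b₀ :+ a₀ :* (con 1ℚ :* b₁)) refl (a 0) (a 1) (b 0) (b 1)
  leibniz (suc n) a b = begin
    nat (2 ℕ.+ n) * (a 0 * b (2 ℕ.+ n) + (a 1 * b (suc n) + d))
      ≡⟨ cong (_* (a 0 * b (2 ℕ.+ n) + (a 1 * b (suc n) + d))) (nat-suc (suc n)) ⟩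
    (1ℚ + ν) * (a 0 * b (2 ℕ.+ n) + (a 1 * b (suc n) + d))
      ≡⟨ solve 6 (λ ν a₀ a₁ b₁ b₂ d → (con 1ℚ :+ ν) :* (a₀ :* b₂ :+ (a₁ :* b₁ :+ d))
           := (con 1ℚ :* a₁ :* b₁ :+ (d :+ ν :* (a₁ :* b₁ :+ d))) :+ a₀ :* ((con 1ℚ :+ ν) :* b₂))
           refl ν (a 0) (a 1) (b (suc n)) (b (2 ℕ.+ n)) d ⟩
    (∂ a 0 * b (suc n) + (d + ν * (a 1 * b (suc n) + d))) + a 0 * ((1ℚ + ν) * b (2 ℕ.+ n))
      ≡⟨ cong₂ (λ p q → (∂ a 0 * b (suc n) + (d + p)) + a 0 * (q * b (2 ℕ.+ n)))
           (leibniz n (a ∘ suc) b) (sym (nat-suc (suc n))) ⟩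
    (∂ a 0 * b (suc n) + (d + (e + f))) + a 0 * ∂ b (suc n)
      ≡⟨ solve 5 (λ p d e f q → (p :+ (d :+ (e :+ f))) :+ q := (p :+ (d :+ e)) :+ (q :+ f)) refl
           (∂ a 0 * b (suc n)) d e f (a 0 * ∂ b (suc n)) ⟩
    (∂ a 0 * b (suc n) + (d + e)) + diagonal (suc n) a (∂ b)
      ≡⟨ cong (λ p → (∂ a 0 * b (suc n) + p) + diagonal (suc n) a (∂ b))
           (trans (sym (diagonal-+ˡ n (a ∘ suc ∘ suc) (∂ (a ∘ suc)) b))
             (diagonal-cong n ∂-shift (λ _ → refl))) ⟩
    diagonal (suc n) (∂ a) b + diagonal (suc n) a (∂ b) ∎
    where
    open ≡-Reasoning
    ν = nat (suc n)
    d = diagonal n (a ∘ suc ∘ suc) b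
    e = diagonal n (∂ (a ∘ suc)) b
    f = diagonal n (a ∘ suc) (∂ b)
    ∂-shift : ∀ k → a (2 ℕ.+ k) + ∂ (a ∘ suc) k ≡ ∂ a (suc k)
    ∂-shift k = trans
      (solve 2 (λ a ν → a :+ ν :* a := (con 1ℚ :+ ν) :* a) refl (a (2 ℕ.+ k)) (nat (suc k)))
      (cong (_* a (2 ℕ.+ k)) (sym (nat-suc (suc k))))

  -- Turns induction on the coefficient index into a uniqueness argument for formal differential
  -- equations: equal constant coefficients and equal derivatives give equal series.
  ∂-injective : ∀ k {a b : ℕ → ℚ} → ∂ a k ≡ ∂ b k → a (suc k) ≡ b (suc k)
  ∂-injective k {a} {b} eq = trans (sym (recip*∂ a)) (trans (cong (recip k *_) eq) (recip*∂ b))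
    where
    recip*∂ : ∀ c → recip k * ∂ c k ≡ c (suc k)
    recip*∂ c = trans (solve 3 (λ r ν c → r :* (ν :* c) := (ν :* r) :* c) refl
        (recip k) (nat (suc k)) (c (suc k)))
      (trans (cong (_* c (suc k)) (nat*recip k)) (*-identityˡ (c (suc k))))

  sinTerm cosTerm : ℚ → ℕ → ℚ
  sinTerm x k = sinCoeff k * term x k
  cosTerm x k = cosCoeff k * term x k

  ∂-weighted-term : ∀ (c : ℕ → ℚ) x k → ∂ (λ k → c k * term x k) k ≡ x * (c (suc k) * term x k)
  ∂-weighted-term c x k = trans
    (solve 5 (λ ν c t x r → ν :* (c :* (t :* (x :* r))) := (ν :* r) :* (x :* (c :* t))) refl
      (nat (suc k)) (c (suc k)) (term x k) x (recip k))
    (trans (cong (_* (x * (c (suc k) * term x k))) (nat*recip k)) (*-identityˡ _))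

  ∂-term : ∀ x k → ∂ (term x) k ≡ x * term x k
  ∂-term x k = trans
    (solve 4 (λ ν t x r → ν :* (t :* (x :* r)) := (ν :* r) :* (x :* t)) refl
      (nat (suc k)) (term x k) x (recip k))
    (trans (cong (_* (x * term x k)) (nat*recip k)) (*-identityˡ _))

  ∂-sinTerm : ∀ x k → ∂ (sinTerm x) k ≡ x * cosTerm x k
  ∂-sinTerm = ∂-weighted-term sinCoeff

  ∂-cosTerm : ∀ x k → ∂ (cosTerm x) k ≡ (- x) * sinTerm x k
  ∂-cosTerm x k = trans (∂-weighted-term cosCoeff x k)
    (solve 3 (λ x c t → x :* ((:- c) :* t) := (:- x) :* (c :* t)) refl x (sinCoeff k) (term x k))

  ∂-diagonal : ∀ n a a̲ b b̲ p q → (∀ k → ∂ a k ≡ p * a̲ k) → (∀ k → ∂ b k ≡ q * b̲ k) →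
               ∂ (λ k → diagonal k a b) n ≡ p * diagonal n a̲ b + q * diagonal n a b̲
  ∂-diagonal n a a̲ b b̲ p q ∂a ∂b = trans (leibniz n a b) (cong₂ _+_
    (trans (diagonal-cong n ∂a (λ _ → refl)) (diagonal-*ˡ n p a̲ b))
    (trans (diagonal-cong n (λ _ → refl) ∂b) (diagonal-*ʳ n q a b̲)))

  -- As series in a formal variable t these are exp(xt) exp(yt) and exp((x + y)t); both have
  -- constant coefficient 1 and satisfy f′ = (x + y) f. Coefficientwise this is the binomial
  -- theorem.
  term-+ : ∀ x y k → diagonal k (term x) (term y) ≡ term (x + y) k
  term-+ x y zero    = refl
  term-+ x y (suc k) = ∂-injective k {λ k → diagonal k (term x) (term y)} {term (x + y)} (begin
    ∂ (λ k → diagonal k (term x) (term y)) k  ≡⟨ ∂-diagonal k (term x) (term x) (term y) (term y) x y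
                                                   (∂-term x) (∂-term y) ⟩
    x * d + y * d                             ≡⟨ *-distribʳ-+ d x y ⟨
    (x + y) * d                               ≡⟨ cong ((x + y) *_) (term-+ x y k) ⟩
    (x + y) * term (x + y) k                  ≡⟨ ∂-term (x + y) k ⟨
    ∂ (term (x + y)) k                        ∎)
    where
    open ≡-Reasoning
    d = diagonal k (term x) (term y)

  -- The two combinations S and C satisfy S′ = (x + y) C and C′ = -(x + y) S, the system solved by
  -- the series of sin and cos of (x + y)t with the same constant coefficients; hence the mutual
  -- induction.
  sinTerm-+ : ∀ x y k → diagonal k (sinTerm x) (cosTerm y) + diagonal k (cosTerm x) (sinTerm y)
                        ≡ sinTerm (x + y) k
  cosTerm-+ : ∀ x y k → diagonal k (cosTerm x) (cosTerm y) - diagonal k (sinTerm x) (sinTerm y)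
                        ≡ cosTerm (x + y) k
  sinTerm-+ x y zero    = refl
  sinTerm-+ x y (suc k) = ∂-injective k {f} {sinTerm (x + y)} (begin
    ∂ f k
      ≡⟨ *-distribˡ-+ (nat (suc k)) _ _ ⟩
    ∂ (λ k → diagonal k (sinTerm x) (cosTerm y)) k + ∂ (λ k → diagonal k (cosTerm x) (sinTerm y)) k
      ≡⟨ cong₂ _+_
           (∂-diagonal k (sinTerm x) (cosTerm x) (cosTerm y) (sinTerm y) x (- y) (∂-sinTerm x) (∂-cosTerm y))
           (∂-diagonal k (cosTerm x) (sinTerm x) (sinTerm y) (cosTerm y) (- x) y (∂-cosTerm x) (∂-sinTerm y)) ⟩
    (x * cc + (- y) * ss) + ((- x) * ss + y * cc)
      ≡⟨ solve 4 (λ x y c s → (x :* c :+ (:- y) :* s) :+ ((:- x) :* s :+ y :* c)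
           := (x :+ y) :* (c :- s)) refl x y cc ss ⟩
    (x + y) * (cc - ss)           ≡⟨ cong ((x + y) *_) (cosTerm-+ x y k) ⟩
    (x + y) * cosTerm (x + y) k   ≡⟨ ∂-sinTerm (x + y) k ⟨
    ∂ (sinTerm (x + y)) k         ∎)
    where
    open ≡-Reasoning
    f = λ k → diagonal k (sinTerm x) (cosTerm y) + diagonal k (cosTerm x) (sinTerm y)
    cc = diagonal k (cosTerm x) (cosTerm y)
    ss = diagonal k (sinTerm x) (sinTerm y)
  cosTerm-+ x y zero    = refl
  cosTerm-+ x y (suc k) = ∂-injective k {f} {cosTerm (x + y)} (begin
    ∂ f k
      ≡⟨ solve 3 (λ ν p q → ν :* (p :- q) := ν :* p :- ν :* q) refl (nat (suc k)) _ _ ⟩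
    ∂ (λ k → diagonal k (cosTerm x) (cosTerm y)) k - ∂ (λ k → diagonal k (sinTerm x) (sinTerm y)) k
      ≡⟨ cong₂ _-_
           (∂-diagonal k (cosTerm x) (sinTerm x) (cosTerm y) (sinTerm y) (- x) (- y) (∂-cosTerm x) (∂-cosTerm y))
           (∂-diagonal k (sinTerm x) (cosTerm x) (sinTerm y) (cosTerm y) x y (∂-sinTerm x) (∂-sinTerm y)) ⟩
    ((- x) * sc + (- y) * cs) - (x * cs + y * sc)
      ≡⟨ solve 4 (λ x y c s → ((:- x) :* s :+ (:- y) :* c) :- (x :* c :+ y :* s)
           := (:- (x :+ y)) :* (s :+ c)) refl x y cs sc ⟩
    (- (x + y)) * (sc + cs)           ≡⟨ cong ((- (x + y)) *_) (sinTerm-+ x y k) ⟩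
    (- (x + y)) * sinTerm (x + y) k   ≡⟨ ∂-cosTerm (x + y) k ⟨
    ∂ (cosTerm (x + y)) k             ∎)
    where
    open ≡-Reasoning
    f = λ k → diagonal k (cosTerm x) (cosTerm y) - diagonal k (sinTerm x) (sinTerm y)
    cs = diagonal k (cosTerm x) (sinTerm y)
    sc = diagonal k (sinTerm x) (cosTerm y)

  -- Again uniqueness for a linear system, now S′ = -x C and C′ = x S.
  sinTerm-neg : ∀ x k → sinTerm (- x) k ≡ - sinTerm x k
  cosTerm-neg : ∀ x k → cosTerm (- x) k ≡ cosTerm x k
  sinTerm-neg x zero    = refl
  sinTerm-neg x (suc k) = ∂-injective k {sinTerm (- x)} {λ k → - sinTerm x k} (begin
    ∂ (sinTerm (- x)) k       ≡⟨ ∂-sinTerm (- x) k ⟩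
    (- x) * cosTerm (- x) k   ≡⟨ cong ((- x) *_) (cosTerm-neg x k) ⟩
    (- x) * cosTerm x k       ≡⟨ solve 2 (λ x c → (:- x) :* c := :- (x :* c)) refl x (cosTerm x k) ⟩
    - (x * cosTerm x k)       ≡⟨ cong -_ (∂-sinTerm x k) ⟨
    - ∂ (sinTerm x) k         ≡⟨ neg-distribʳ-* (nat (suc k)) (sinTerm x (suc k)) ⟩
    ∂ (λ k → - sinTerm x k) k ∎)
    where open ≡-Reasoning
  cosTerm-neg x zero    = refl
  cosTerm-neg x (suc k) = ∂-injective k {cosTerm (- x)} {cosTerm x} (begin
    ∂ (cosTerm (- x)) k           ≡⟨ ∂-cosTerm (- x) k ⟩
    (- (- x)) * sinTerm (- x) k   ≡⟨ cong ((- (- x)) *_) (sinTerm-neg x k) ⟩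
    (- (- x)) * (- sinTerm x k)   ≡⟨ solve 2 (λ x c → (:- (:- x)) :* (:- c) := (:- x) :* c) refl x (sinTerm x k) ⟩
    (- x) * sinTerm x k           ≡⟨ ∂-cosTerm x k ⟨
    ∂ (cosTerm x) k               ∎)
    where open ≡-Reasoning

  sinPoly-neg : ∀ n x → sinPoly n (- x) ≡ - sinPoly n x
  sinPoly-neg n x = trans (Σ<-cong n (sinTerm-neg x)) (Σ<-neg n (sinTerm x))

  cosPoly-neg : ∀ n x → cosPoly n (- x) ≡ cosPoly n x
  cosPoly-neg n x = Σ<-cong n (cosTerm-neg x)

  -- Truncation error of the Cauchy product

  Σ<-diff-bound : ∀ {b b̄ : ℕ → ℚ} → (∀ k → ∣ b k ∣ ≤ b̄ k) → ∀ {m n} → m ℕ.≤ n →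
                  ∣ Σ< n b - Σ< m b ∣ ≤ Σ< n b̄ - Σ< m b̄
  Σ<-diff-bound {b} {b̄} ∣b∣≤b̄ {n = zero} ℕ.z≤n = ≤-refl
  Σ<-diff-bound {b} {b̄} ∣b∣≤b̄ {n = suc n} ℕ.z≤n = begin
    ∣ (Σ< n b + b n) - 0ℚ ∣   ≡⟨ cong ∣_∣ (solve 2 (λ s b → (s :+ b) :- con 0ℚ := (s :- con 0ℚ) :+ b) refl (Σ< n b) (b n)) ⟩
    ∣ (Σ< n b - 0ℚ) + b n ∣   ≤⟨ ∣p+q∣≤∣p∣+∣q∣ (Σ< n b - 0ℚ) (b n) ⟩
    ∣ Σ< n b - 0ℚ ∣ + ∣ b n ∣ ≤⟨ +-mono-≤ (Σ<-diff-bound ∣b∣≤b̄ {0} {n} ℕ.z≤n) (∣b∣≤b̄ n) ⟩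
    (Σ< n b̄ - 0ℚ) + b̄ n       ≡⟨ solve 2 (λ s b → (s :- con 0ℚ) :+ b := (s :+ b) :- con 0ℚ) refl (Σ< n b̄) (b̄ n) ⟩
    (Σ< n b̄ + b̄ n) - 0ℚ       ∎
    where open ≤-Reasoning
  Σ<-diff-bound {b} {b̄} ∣b∣≤b̄ {suc m} {suc n} (ℕ.s≤s m≤n) =
    subst₂ (λ p q → ∣ p ∣ ≤ q) (peel b) (peel b̄) (Σ<-diff-bound (λ k → ∣b∣≤b̄ (suc k)) m≤n)
    where
    peel : ∀ c → Σ< n (c ∘ suc) - Σ< m (c ∘ suc) ≡ Σ< (suc n) c - Σ< (suc m) c
    peel c = trans (solve 3 (λ c s t → s :- t := (c :+ s) :- (c :+ t)) refl (c 0) (Σ< n (c ∘ suc)) (Σ< m (c ∘ suc)))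
      (sym (cong₂ _-_ (Σ<-head n c) (Σ<-head m c)))

  rectangle-peel : ∀ m n a b → Σ< (suc m) a * Σ< n b - triangle (suc m) a b ≡
    a 0 * (Σ< n b - Σ< (suc m) b) + (Σ< m (a ∘ suc) * Σ< n b - triangle m (a ∘ suc) b)
  rectangle-peel m n a b = trans (cong (λ s → s * Σ< n b - triangle (suc m) a b) (Σ<-head m a))
    (solve 5 (λ a s N M t → (a :+ s) :* N :- (a :* M :+ t) := a :* (N :- M) :+ (s :* N :- t)) refl
      (a 0) (Σ< m (a ∘ suc)) (Σ< n b) (Σ< (suc m) b) (triangle m (a ∘ suc) b))

  -- For `m ≤ n` the triangle lies inside the m by n rectangle, so both differences are sums over
  -- the same pairs i < m, j < n with i + j ≥ m, and the majorants apply termwise. Two sizes are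
  -- kept because the induction over rows shrinks `m` but not the row length `n`.
  rectangle-triangle-bound : ∀ {a ā b b̄ : ℕ → ℚ} → (∀ k → ∣ a k ∣ ≤ ā k) → (∀ k → ∣ b k ∣ ≤ b̄ k) →
    ∀ {m n} → m ℕ.≤ n →
    ∣ Σ< m a * Σ< n b - triangle m a b ∣ ≤ Σ< m ā * Σ< n b̄ - triangle m ā b̄
  rectangle-triangle-bound {b = b} {b̄} ∣a∣≤ā ∣b∣≤b̄ {zero} {n} _ = ≤-reflexive (trans
    (cong ∣_∣ (zero-rect b)) (sym (zero-rect b̄)))
    where
    zero-rect : ∀ c → 0ℚ * Σ< n c - 0ℚ ≡ 0ℚ
    zero-rect c = solve 1 (λ s → con 0ℚ :* s :- con 0ℚ := con 0ℚ) refl (Σ< n c)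
  rectangle-triangle-bound {a} {ā} {b} {b̄} ∣a∣≤ā ∣b∣≤b̄ {suc m} {n} m<n = begin
    ∣ Σ< (suc m) a * Σ< n b - triangle (suc m) a b ∣
      ≡⟨ cong ∣_∣ (rectangle-peel m n a b) ⟩
    ∣ a 0 * (Σ< n b - Σ< (suc m) b) + (Σ< m (a ∘ suc) * Σ< n b - triangle m (a ∘ suc) b) ∣
      ≤⟨ ∣p+q∣≤∣p∣+∣q∣ (a 0 * (Σ< n b - Σ< (suc m) b)) _ ⟩
    ∣ a 0 * (Σ< n b - Σ< (suc m) b) ∣ + ∣ Σ< m (a ∘ suc) * Σ< n b - triangle m (a ∘ suc) b ∣
      ≤⟨ +-mono-≤
           (≤-trans (≤-reflexive (∣p*q∣≡∣p∣*∣q∣ (a 0) _))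
             (*-mono-≤′ (≤-trans (0≤∣p∣ (a 0)) (∣a∣≤ā 0)) (0≤∣p∣ (Σ< n b - Σ< (suc m) b))
               (∣a∣≤ā 0) (Σ<-diff-bound ∣b∣≤b̄ m<n)))
           (rectangle-triangle-bound (λ k → ∣a∣≤ā (suc k)) ∣b∣≤b̄ (ℕₚ.<⇒≤ m<n)) ⟩
    ā 0 * (Σ< n b̄ - Σ< (suc m) b̄) + (Σ< m (ā ∘ suc) * Σ< n b̄ - triangle m (ā ∘ suc) b̄)
      ≡⟨ rectangle-peel m n ā b̄ ⟨
    Σ< (suc m) ā * Σ< n b̄ - triangle (suc m) ā b̄ ∎
    where open ≤-Reasoning

  triangle-nonNeg : ∀ n {a b} → (∀ k → 0ℚ ≤ a k) → (∀ k → 0ℚ ≤ b k) → 0ℚ ≤ triangle n a b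
  triangle-nonNeg zero    0≤a 0≤b = ≤-refl
  triangle-nonNeg (suc n) 0≤a 0≤b =
    0≤-+ (0≤-* (0≤a 0) (Σ<-nonNeg (suc n) 0≤b)) (triangle-nonNeg n (λ k → 0≤a (suc k)) 0≤b)

  -- Indices i < m and j < n satisfy i + j < m + n, and the further entries of the triangle are
  -- nonnegative.
  rectangle≤triangle : ∀ m n {a b} → (∀ k → 0ℚ ≤ a k) → (∀ k → 0ℚ ≤ b k) →
                       Σ< m a * Σ< n b ≤ triangle (m ℕ.+ n) a b
  rectangle≤triangle zero n {a} {b} 0≤a 0≤b =
    subst (_≤ triangle n a b) (sym (*-zeroˡ (Σ< n b))) (triangle-nonNeg n 0≤a 0≤b)
  rectangle≤triangle (suc m) n {a} {b} 0≤a 0≤b = begin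
    Σ< (suc m) a * Σ< n b                     ≡⟨ cong (_* Σ< n b) (Σ<-head m a) ⟩
    (a 0 + Σ< m (a ∘ suc)) * Σ< n b           ≡⟨ *-distribʳ-+ (Σ< n b) (a 0) (Σ< m (a ∘ suc)) ⟩
    a 0 * Σ< n b + Σ< m (a ∘ suc) * Σ< n b
      ≤⟨ +-mono-≤ (*-monoˡ (0≤a 0) (Σ<-mono 0≤b (ℕₚ.m≤n⇒m≤1+n (ℕₚ.m≤n+m n m))))
           (rectangle≤triangle m n (λ k → 0≤a (suc k)) 0≤b) ⟩
    triangle (suc m ℕ.+ n) a b                ∎
    where open ≤-Reasoning

  triangle-term : ∀ n M → triangle n (term M) (term M) ≡ Σ< n (term (M + M))
  triangle-term n M = trans (triangle≡Σdiagonal n (term M) (term M)) (Σ<-cong n (term-+ M M))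

  -- The Cauchy product of truncated exponential series misses at most the tail
  -- between n and 2n of the exponential series at 2M.
  cauchy-product-error : ∀ {a b : ℕ → ℚ} {M} → 0ℚ ≤ M →
    (∀ k → ∣ a k ∣ ≤ term M k) → (∀ k → ∣ b k ∣ ≤ term M k) → ∀ n →
    ∣ Σ< n a * Σ< n b - triangle n a b ∣ ≤ Σ< (n ℕ.+ n) (term (M + M)) - Σ< n (term (M + M))
  cauchy-product-error {a} {b} {M} 0≤M ∣a∣≤ ∣b∣≤ n = begin
    ∣ Σ< n a * Σ< n b - triangle n a b ∣
      ≤⟨ rectangle-triangle-bound ∣a∣≤ ∣b∣≤ (ℕₚ.≤-refl {n}) ⟩
    Σ< n (term M) * Σ< n (term M) - triangle n (term M) (term M)
      ≤⟨ +-monoˡ-≤ (- triangle n (term M) (term M))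
           (rectangle≤triangle n n (term-nonNeg 0≤M) (term-nonNeg 0≤M)) ⟩
    triangle (n ℕ.+ n) (term M) (term M) - triangle n (term M) (term M)
      ≡⟨ cong₂ _-_ (triangle-term (n ℕ.+ n) M) (triangle-term n M) ⟩
    Σ< (n ℕ.+ n) (term (M + M)) - Σ< n (term (M + M)) ∎
    where open ≤-Reasoning

  -- With all coefficients 1, `taylor` is the exponential series, so its tails are controlled by
  -- `cauchy-series`.
  exp-tail : ∀ M ε → 0ℚ < ε → ∃[ N ] (∀ n → N ℕ.≤ n → Σ< (n ℕ.+ n) (term M) - Σ< n (term M) < ε)
  exp-tail M ε 0<ε =
    let (N , close) = cauchy-series (λ _ → 1ℚ) (λ _ → ≤-refl) {λ _ → M} (cauchy-const M) ε 0<ε in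
    N , λ n N≤n → ≤-<-trans (p≤∣p∣ _)
      (subst (_< ε) (cong₂ (λ p q → ∣ p - q ∣) (exp (n ℕ.+ n)) (exp n))
        (close (n ℕ.+ n) n (ℕₚ.≤-trans N≤n (ℕₚ.m≤m+n n n)) N≤n))
    where
    exp : ∀ n → taylor (λ _ → 1ℚ) n M ≡ Σ< n (term M)
    exp n = Σ<-cong n (λ k → *-identityˡ (term M k))

  sinPoly-+-triangle : ∀ n x y → triangle n (sinTerm x) (cosTerm y) + triangle n (cosTerm x) (sinTerm y)
                                 ≡ sinPoly n (x + y)
  sinPoly-+-triangle n x y = trans
    (cong₂ _+_ (triangle≡Σdiagonal n (sinTerm x) (cosTerm y)) (triangle≡Σdiagonal n (cosTerm x) (sinTerm y)))
    (trans (sym (Σ<-+ n _ _)) (Σ<-cong n (sinTerm-+ x y)))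

  -- The threshold `N` depends only on `M` and `ε`, because the arguments will be the n-th
  -- approximations of two reals and so vary with n.
  sinPoly-+-error : ∀ M ε → 0ℚ ≤ M → 0ℚ < ε → ∃[ N ] (∀ n → N ℕ.≤ n → ∀ x y → ∣ x ∣ ≤ M → ∣ y ∣ ≤ M →
    ∣ sinPoly n (x + y) - (sinPoly n x * cosPoly n y + cosPoly n x * sinPoly n y) ∣ < ε)
  sinPoly-+-error M ε 0≤M 0<ε =
    let (N , small) = exp-tail (M + M) (½ * ε) (0<half 0<ε) in
    N , λ n N≤n x y ∣x∣≤M ∣y∣≤M →
      let bound = λ {a b : ℕ → ℚ} (∣a∣≤ : ∀ k → ∣ a k ∣ ≤ term M k) (∣b∣≤ : ∀ k → ∣ b k ∣ ≤ term M k) →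
            ≤-<-trans (cauchy-product-error {a} {b} 0≤M ∣a∣≤ ∣b∣≤ n) (small n N≤n)
          ∣sin∣ = λ {z} (∣z∣≤M : ∣ z ∣ ≤ M) k → ∣weighted-term∣ {x = z} k (∣sinCoeff∣≤1 k) ∣z∣≤M
          ∣cos∣ = λ {z} (∣z∣≤M : ∣ z ∣ ≤ M) k → ∣weighted-term∣ {x = z} k (∣cosCoeff∣≤1 k) ∣z∣≤M
          p = sinPoly n x * cosPoly n y
          q = cosPoly n x * sinPoly n y
          p̲ = triangle n (sinTerm x) (cosTerm y)
          q̲ = triangle n (cosTerm x) (sinTerm y)
      -- `sinPoly n (x + y)` equals the sum of the two triangles, so the error is minus the sum of
      -- two differences between rectangle and triangle, each below ε/2.
      in subst (λ d → ∣ d ∣ < ε)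
           (trans (solve 4 (λ p q p̲ q̲ → :- ((p :- p̲) :+ (q :- q̲)) := (p̲ :+ q̲) :- (p :+ q)) refl p q p̲ q̲)
             (cong (_- (p + q)) (sinPoly-+-triangle n x y)))
           (subst (_< ε) (sym (∣-p∣≡∣p∣ ((p - p̲) + (q - q̲))))
             (≤-<-trans (∣p+q∣≤∣p∣+∣q∣ (p - p̲) (q - q̲))
               (+-halves (bound (∣sin∣ ∣x∣≤M) (∣cos∣ ∣y∣≤M)) (bound (∣cos∣ ∣x∣≤M) (∣sin∣ ∣y∣≤M)))))

  -- Estimates of the Taylor polynomials on [0, 2]

  x²≤4 : ∀ {x} → 0ℚ ≤ x → x ≤ nat 2 → x * x ≤ nat 4
  x²≤4 0≤x x≤2 = *-mono-≤′ (0≤nat 2) 0≤x x≤2 x≤2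

  -- The alternating tail after the linear term is at most its first term x³/6, and x - x³/6 ≥ x/3
  -- because x² ≤ 4.
  sinPoly-lower : ∀ m {x} → 0ℚ ≤ x → x ≤ nat 2 → (ℤ.+ 1 / 3) * x ≤ sinPoly (3 ℕ.+ m) x
  sinPoly-lower m {x} 0≤x x≤2 = ≤-by
    (0≤-+ (0≤-* (nonNegative⁻¹ (ℤ.+ 1 / 6)) (0≤-* 0≤x (0≤-∸ (x²≤4 0≤x x≤2)))) (0≤-∸ A≤))
    (trans (trans (Σ<-head (2 ℕ.+ m) (sinTerm x)) (cong (0ℚ * 1ℚ +_) (alternating-peel m (λ k → term x (suc k)))))
      (solve 2 (λ x a →
        let t₁ = con 1ℚ :* (x :* con (recip 0))
            t₃ = (t₁ :* (x :* con (recip 1))) :* (x :* con (recip 2))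
        in con (0ℚ * 1ℚ) :+ (t₁ :- a) := con (ℤ.+ 1 / 3) :* x
             :+ (con (ℤ.+ 1 / 6) :* (x :* (con (nat 4) :- x :* x)) :+ (t₃ :- a)))
        refl x A))
    where
    d : ℕ → ℚ
    d k = term x (3 ℕ.+ k)
    A = alternating m d
    0≤t = term-nonNeg 0≤x
    -- Passing from k to k + 2 multiplies the term by x²/((k + 4)(k + 5)) ≤ 4/20.
    dec : ∀ k → d (2 ℕ.+ k) ≤ d k
    dec k = ≤-by
      (0≤-* (0≤t (3 ℕ.+ k)) (0≤-∸ σx²≤1))
      (solve 4 (λ t x r s → t := (t :* (x :* r)) :* (x :* s) :+ t :* (con 1ℚ :- (r :* s) :* (x :* x)))
        refl (d k) x (recip (3 ℕ.+ k)) (recip (4 ℕ.+ k)))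
      where
      σx²≤1 : (recip (3 ℕ.+ k) * recip (4 ℕ.+ k)) * (x * x) ≤ 1ℚ
      σx²≤1 = ≤-trans
        (*-mono-≤′ (nonNegative⁻¹ (recip 3 * recip 4)) (0≤x² x)
          (*-mono-≤′ (0≤recip 3) (0≤recip (4 ℕ.+ k)) (recip-antitone 3 k) (recip-antitone 4 k))
          (x²≤4 0≤x x≤2))
        (ℚ-lit refl)
    A≤ : A ≤ d 0
    A≤ = proj₂ (alternating-bounds m d (λ k → 0≤t (3 ℕ.+ k)) dec)

  -- `cosPoly-diff` bounds the decrease below by (y² - x²)(1/2 - (x² + y²)/24), and x² + y² ≤ 8
  -- makes the second factor at least 1/6. Taken with y approximating π/2, this keeps `cos` away
  -- from 0 below π/2.
  cosPoly-decrease : ∀ m {x y} → 0ℚ ≤ x → x ≤ y → y ≤ nat 2 →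
    cosPoly (4 ℕ.+ m) y + (y - x) * (y + x) * (ℤ.+ 1 / 6) ≤ cosPoly (4 ℕ.+ m) x
  cosPoly-decrease m {x} {y} 0≤x x≤y y≤2 = ≤-by
    (0≤-+ (0≤-* (nonNegative⁻¹ (ℤ.+ 1 / 24))
             (0≤-* (0≤-* (0≤-∸ x≤y) (0≤-+ 0≤y 0≤x)) (0≤-∸ (+-mono-≤ (x²≤4 0≤y y≤2) (x²≤4 0≤x (≤-trans x≤y y≤2))))))
          (0≤-∸ (proj₁ (cosPoly-diff m 0≤x x≤y y≤2))))
    (solve 4 (λ x y c e →
      c := (e :+ (y :- x) :* (y :+ x) :* con (ℤ.+ 1 / 6))
        :+ (con (ℤ.+ 1 / 24) :* ((y :- x) :* (y :+ x) :* (con (nat 8) :- (y :* y :+ x :* x)))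
          :+ ((c :- e) :- (con ½ :* (y :* y :- x :* x)
                :- con (ℤ.+ 1 / 24) :* (y :* y :* (y :* y) :- x :* x :* (x :* x))))))
      refl x y (cosPoly (4 ℕ.+ m) x) (cosPoly (4 ℕ.+ m) y))
    where 0≤y = ≤-trans 0≤x x≤y

  -- The algebraic identity of the elimination

  -- The three-term and two-term brackets are, in order, the translated conditions for (2,4,6),
  -- (2,8,9), (3,5,8), (1,5,9), (6,7,10) and (1,5,10). The separate terms in `h₄` and `h₃`, positive
  -- by (1,4,7) and (1,3,7), cancel those variables in the brackets of (2,4,6) and (3,5,8). All
  -- letters are independent rationals, so the identity applies to each approximation.
  elimination : ∀ h₂ h₃ h₄ h₅ h₆ h₈ h₉ h₁₀
      s₁₅ s₁₉ s₁₁₀ s₂₄ s₂₆ s₂₈ s₂₉ s₃₅ s₃₈ s₄₆ s₅₈ s₆₇ s₇₁₀ s₈₉ →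
      s₁₅ * s₃₅ * s₇₁₀ * (s₈₉ * (h₂ * s₄₆ - h₄ * s₂₆ + h₆ * s₂₄) + s₈₉ * s₂₆ * h₄
                        + s₄₆ * (- h₂ * s₈₉ + h₈ * s₂₉ - h₉ * s₂₈))
      + s₇₁₀ * s₁₅ * s₄₆ * s₂₉ * ((- h₃ * s₅₈ + h₅ * s₃₈ - h₈ * s₃₅) + h₃ * s₅₈)
      + s₄₆ * s₂₈ * s₃₅ * s₇₁₀ * (h₉ * s₁₅ - h₅ * s₁₉)
      + s₈₉ * s₂₄ * s₁₅ * s₃₅ * (- h₆ * s₇₁₀ - h₁₀ * s₆₇)
      + s₈₉ * s₂₄ * s₃₅ * s₆₇ * (h₁₀ * s₁₅ - h₅ * s₁₁₀)
      ≡ (s₈₉ * s₁₁₀ * s₂₄ * s₃₅ * s₆₇ + s₄₆ * s₁₉ * s₇₁₀ * s₃₅ * s₂₈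
        - s₄₆ * s₃₈ * s₇₁₀ * s₂₉ * s₁₅) * - h₅
  elimination = solve 22 (λ h₂ h₃ h₄ h₅ h₆ h₈ h₉ h₁₀
      s₁₅ s₁₉ s₁₁₀ s₂₄ s₂₆ s₂₈ s₂₉ s₃₅ s₃₈ s₄₆ s₅₈ s₆₇ s₇₁₀ s₈₉ →
      s₁₅ :* s₃₅ :* s₇₁₀ :* (s₈₉ :* (h₂ :* s₄₆ :- h₄ :* s₂₆ :+ h₆ :* s₂₄) :+ s₈₉ :* s₂₆ :* h₄
                        :+ s₄₆ :* (:- h₂ :* s₈₉ :+ h₈ :* s₂₉ :- h₉ :* s₂₈))
      :+ s₇₁₀ :* s₁₅ :* s₄₆ :* s₂₉ :* ((:- h₃ :* s₅₈ :+ h₅ :* s₃₈ :- h₈ :* s₃₅) :+ h₃ :* s₅₈)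
      :+ s₄₆ :* s₂₈ :* s₃₅ :* s₇₁₀ :* (h₉ :* s₁₅ :- h₅ :* s₁₉)
      :+ s₈₉ :* s₂₄ :* s₁₅ :* s₃₅ :* (:- h₆ :* s₇₁₀ :- h₁₀ :* s₆₇)
      :+ s₈₉ :* s₂₄ :* s₃₅ :* s₆₇ :* (h₁₀ :* s₁₅ :- h₅ :* s₁₁₀)
      := (s₈₉ :* s₁₁₀ :* s₂₄ :* s₃₅ :* s₆₇ :+ s₄₆ :* s₁₉ :* s₇₁₀ :* s₃₅ :* s₂₈
        :- s₄₆ :* s₃₈ :* s₇₁₀ :* s₂₉ :* s₁₅) :* :- h₅) refl

open TaylorPolynomials
open RationalSequences
  using (Cauchy; cauchy-+; cauchy-neg; cauchy-*; 0<-*; ∣-∣-sym; ∣-∣-triangle; half+half; 0<half;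
         +-halves; bounded; *-monoʳ; *-monoˡ; nat)
open import Defs hiding (module RationalSequences)

-- Equality and positivity of limits of rational sequences

Eventually : (ℕ → Set) → Set
Eventually P = ∃[ N ] (∀ n → N ℕ.≤ n → P n)

eventually : ∀ {P Q : ℕ → Set} → (∀ n → P n → Q n) → Eventually P → Eventually Q
eventually f (N , p) = N , λ n N≤n → f n (p n N≤n)

both : ∀ {P Q : ℕ → Set} → Eventually P → Eventually Q → Eventually (λ n → P n × Q n)
both (M , p) (N , q) = M ℕ.⊔ N , λ n M⊔N≤n →
  p n (ℕₚ.m⊔n≤o⇒m≤o M N M⊔N≤n) , q n (ℕₚ.m⊔n≤o⇒n≤o M N M⊔N≤n)

from : ∀ {P : ℕ → Set} N → (∀ m → P (N ℕ.+ m)) → Eventually P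
from {P} N p = N , λ n N≤n → subst P (ℕₚ.m+[n∸m]≡n N≤n) (p (n ℕ.∸ N))

-- A relation between sequences, and a record, so that its arguments can be
-- inferred: comparing two reals would compare their Cauchy moduli.  Keeping the
-- Cauchy property makes the relation a congruence for multiplication.

record _∼_ (f g : ℕ → ℚ) : Set where
  constructor mk∼
  field
    cauchyˡ : Cauchy f
    cauchyʳ : Cauchy g
    close   : ∀ ε → 0ℚ ℚ.< ε → Eventually (λ n → ℚ.∣ f n ℚ.- g n ∣ ℚ.< ε)

-- A fixed lower bound, since eventual positivity of the terms alone would allow the limit 0.
record Pos (f : ℕ → ℚ) : Set where
  constructor mkPos
  field
    bound   : ℚ
    0<bound : 0ℚ ℚ.< bound
    bound<  : Eventually (λ n → bound ℚ.< f n)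

infix  4 _∼_ _≋_
infixl 6 _⊕_ _⊖_ _+ₚ_
infixl 7 _⊗_ _*ₚ_
infix  8 ⊝_

_≋_ : ℝ → ℝ → Set
x ≋ y = approx x ∼ approx y

Positive : ℝ → Set
Positive x = Pos (approx x)

≈⇒≋ : ∀ x y → x ≈ y → x ≋ y
≈⇒≋ x y x≈y = mk∼ (cauchy x) (cauchy y) x≈y

≗⇒≋ : ∀ x y → (∀ n → approx x n ≡ approx y n) → x ≋ y
≗⇒≋ x y eq = ≈⇒≋ x y λ ε 0<ε → 0 , λ n _ →
  subst (λ d → ℚ.∣ d ∣ ℚ.< ε) (sym (trans (cong (ℚ._- approx y n) (eq n)) (ℚₚ.+-inverseʳ (approx y n)))) 0<ε

≋-refl : ∀ x → x ≋ x
≋-refl x = ≗⇒≋ x x λ _ → refl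

∼-sym : ∀ {f g} → f ∼ g → g ∼ f
∼-sym {f} {g} (mk∼ cf cg close) = mk∼ cg cf λ ε 0<ε →
  eventually (λ n → subst (ℚ._< ε) (∣-∣-sym (f n) (g n))) (close ε 0<ε)

∼-trans : ∀ {f g h} → f ∼ g → g ∼ h → f ∼ h
∼-trans {f} {g} {h} (mk∼ cf _ p) (mk∼ _ ch q) = mk∼ cf ch λ ε 0<ε →
  eventually (λ n (p , q) → ℚₚ.≤-<-trans (∣-∣-triangle (f n) (g n) (h n)) (+-halves p q))
    (both (p (½ ℚ.* ε) (0<half 0<ε)) (q (½ ℚ.* ε) (0<half 0<ε)))

_⊕_ : ∀ {f f′ g g′} → f ∼ f′ → g ∼ g′ → (λ n → f n ℚ.+ g n) ∼ (λ n → f′ n ℚ.+ g′ n)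
_⊕_ {f} {f′} {g} {g′} (mk∼ cf cf′ p) (mk∼ cg cg′ q) =
  mk∼ (cauchy-+ {f} {g} cf cg) (cauchy-+ {f′} {g′} cf′ cg′) λ ε 0<ε →
  eventually (λ n (p , q) → subst (λ d → ℚ.∣ d ∣ ℚ.< ε)
      (solve 4 (λ a b c d → (a :- b) :+ (c :- d) := (a :+ c) :- (b :+ d)) refl (f n) (f′ n) (g n) (g′ n))
      (ℚₚ.≤-<-trans (ℚₚ.∣p+q∣≤∣p∣+∣q∣ (f n ℚ.- f′ n) (g n ℚ.- g′ n)) (+-halves p q)))
    (both (p (½ ℚ.* ε) (0<half 0<ε)) (q (½ ℚ.* ε) (0<half 0<ε)))

⊝_ : ∀ {f f′} → f ∼ f′ → (λ n → ℚ.- f n) ∼ (λ n → ℚ.- f′ n)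
⊝_ {f} {f′} (mk∼ cf cf′ p) = mk∼ (cauchy-neg {f} cf) (cauchy-neg {f′} cf′) λ ε 0<ε →
  eventually (λ n → subst (ℚ._< ε) (trans (∣-∣-sym (f n) (f′ n))
      (cong ℚ.∣_∣ (solve 2 (λ a b → b :- a := :- a :- :- b) refl (f n) (f′ n)))))
    (p ε 0<ε)

_⊖_ : ∀ {f f′ g g′} → f ∼ f′ → g ∼ g′ → (λ n → f n ℚ.- g n) ∼ (λ n → f′ n ℚ.- g′ n)
p ⊖ q = p ⊕ (⊝ q)

divide : ∀ {p q} → 0ℚ ℚ.< p → 0ℚ ℚ.< q → ∃[ r ] (0ℚ ℚ.< r × r ℚ.* q ≡ p)
divide {p} {q} 0<p 0<q = p ℚ.* 1/q , 0<-* 0<p 0<1/q ,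
  trans (ℚₚ.*-assoc p 1/q q) (trans (cong (p ℚ.*_) (ℚₚ.*-inverseˡ q {{ℚ.>-nonZero 0<q}})) (ℚₚ.*-identityʳ p))
  where
  1/q = (ℚ.1/ q) {{ℚ.>-nonZero 0<q}}
  0<1/q : 0ℚ ℚ.< 1/q
  0<1/q = ℚₚ.positive⁻¹ 1/q {{ℚₚ.1/pos⇒pos q {{ℚ.positive 0<q}}}}

small-* : ∀ {f g f′ : ℕ → ℚ} → Cauchy g → (∀ ε → 0ℚ ℚ.< ε → Eventually (λ n → ℚ.∣ f n ℚ.- f′ n ∣ ℚ.< ε)) →
          ∀ ε → 0ℚ ℚ.< ε → Eventually (λ n → ℚ.∣ (f n ℚ.- f′ n) ℚ.* g n ∣ ℚ.< ε)
small-* {f} {g} {f′} cg p ε 0<ε =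
  let (B , 0<B , ∣g∣≤B) = bounded {g} cg
      (η , 0<η , η*B≡ε) = divide 0<ε 0<B
  in eventually (λ n ∣f-f′∣< → begin-strict
       ℚ.∣ (f n ℚ.- f′ n) ℚ.* g n ∣         ≡⟨ ℚₚ.∣p*q∣≡∣p∣*∣q∣ (f n ℚ.- f′ n) (g n) ⟩
       ℚ.∣ f n ℚ.- f′ n ∣ ℚ.* ℚ.∣ g n ∣     ≤⟨ *-monoˡ (ℚₚ.0≤∣p∣ (f n ℚ.- f′ n)) (∣g∣≤B n) ⟩
       ℚ.∣ f n ℚ.- f′ n ∣ ℚ.* B             <⟨ ℚₚ.*-monoˡ-<-pos B {{ℚ.positive 0<B}} ∣f-f′∣< ⟩
       η ℚ.* B                              ≡⟨ η*B≡ε ⟩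
       ε                                    ∎)
     (p η 0<η)
  where open ℚₚ.≤-Reasoning

_⊗_ : ∀ {f f′ g g′} → f ∼ f′ → g ∼ g′ → (λ n → f n ℚ.* g n) ∼ (λ n → f′ n ℚ.* g′ n)
_⊗_ {f} {f′} {g} {g′} (mk∼ cf cf′ p) (mk∼ cg cg′ q) =
  mk∼ (cauchy-* {f} {g} cf cg) (cauchy-* {f′} {g′} cf′ cg′) λ ε 0<ε →
  eventually (λ n (p , q) → subst (λ d → ℚ.∣ d ∣ ℚ.< ε)
      (solve 4 (λ a b c d → (a :- b) :* c :+ (c :- d) :* b := a :* c :- b :* d) refl (f n) (f′ n) (g n) (g′ n))
      (ℚₚ.≤-<-trans (ℚₚ.∣p+q∣≤∣p∣+∣q∣ ((f n ℚ.- f′ n) ℚ.* g n) ((g n ℚ.- g′ n) ℚ.* f′ n)) (+-halves p q)))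
    (both (small-* {f} {g} {f′} cg p (½ ℚ.* ε) (0<half 0<ε))
          (small-* {g} {f′} {g′} cf′ q (½ ℚ.* ε) (0<half 0<ε)))

0<⇒positive : ∀ x → 0ℝ < x → Positive x
0<⇒positive x (ε , 0<ε , ev) = mkPos ε 0<ε
  (eventually (λ n → subst (ℚ._< approx x n) (ℚₚ.+-identityˡ ε)) ev)

positive⇒0< : ∀ x → Positive x → 0ℝ < x
positive⇒0< x (mkPos ε 0<ε ev) = ε , 0<ε ,
  eventually (λ n → subst (ℚ._< approx x n) (sym (ℚₚ.+-identityˡ ε))) ev

<⇒positive : ∀ x y → x < y → Positive (y - x)
<⇒positive x y (ε , 0<ε , ev) = mkPos ε 0<ε (eventually
  (λ n → subst₂ ℚ._<_ (solve 2 (λ x ε → (x :+ ε) :- x := ε) refl (approx x n) ε) refl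
    ∘ ℚₚ.+-monoˡ-< (ℚ.- approx x n)) ev)

pos-mono : ∀ {f g} → Eventually (λ n → f n ℚ.≤ g n) → Pos f → Pos g
pos-mono f≤g (mkPos ε 0<ε ev) =
  mkPos ε 0<ε (eventually (λ n (f≤g , ε<f) → ℚₚ.<-≤-trans ε<f f≤g) (both f≤g ev))

pos-≗ : ∀ {f g} → (∀ n → f n ≡ g n) → Pos f → Pos g
pos-≗ eq = pos-mono (0 , λ n _ → ℚₚ.≤-reflexive (eq n))

-- Half of the lower bound is given up to the distance between the sequences, which is eventually
-- smaller than that.
pos-∼ : ∀ {f g} → f ∼ g → Pos f → Pos g
pos-∼ {f} {g} f∼g (mkPos ε 0<ε ev) =
  mkPos (½ ℚ.* ε) (0<half 0<ε) (eventually (λ n (ε<f , f-g<) → begin-strict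
      ½ ℚ.* ε                        ≡⟨ solve 1 (λ ε → con ½ :* ε := ε :- con ½ :* ε) refl ε ⟩
      ε ℚ.- ½ ℚ.* ε                  <⟨ ℚₚ.+-mono-< ε<f (ℚₚ.neg-antimono-< f-g<) ⟩
      f n ℚ.- ℚ.∣ f n ℚ.- g n ∣      ≤⟨ ℚₚ.+-monoʳ-≤ (f n) (ℚₚ.neg-antimono-≤ (p≤∣p∣ (f n ℚ.- g n))) ⟩
      f n ℚ.- (f n ℚ.- g n)          ≡⟨ solve 2 (λ x y → x :- (x :- y) := y) refl (f n) (g n) ⟩
      g n                            ∎)
    (both ev (_∼_.close f∼g (½ ℚ.* ε) (0<half 0<ε))))
  where open ℚₚ.≤-Reasoning

_+ₚ_ : ∀ {f g} → Pos f → Pos g → Pos (λ n → f n ℚ.+ g n)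
mkPos ε 0<ε ε<f +ₚ mkPos δ 0<δ δ<g =
  mkPos (ε ℚ.+ δ) (ℚₚ.+-mono-< 0<ε 0<δ) (eventually (λ n (p , q) → ℚₚ.+-mono-< p q) (both ε<f δ<g))

_*ₚ_ : ∀ {f g} → Pos f → Pos g → Pos (λ n → f n ℚ.* g n)
mkPos ε 0<ε ε<f *ₚ mkPos δ 0<δ δ<g =
  mkPos (ε ℚ.* δ) (0<-* 0<ε 0<δ) (eventually (λ n (p , q) →
    ℚₚ.<-≤-trans (ℚₚ.*-monoʳ-<-pos ε {{ℚ.positive 0<ε}} q)
      (*-monoʳ (ℚₚ.<⇒≤ (ℚₚ.<-trans 0<δ q)) (ℚₚ.<⇒≤ p))) (both ε<f δ<g))

pos-const : ∀ {q} → 0ℚ ℚ.< q → Pos (λ _ → q)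
pos-const {q} 0<q = mkPos (½ ℚ.* q) (0<half 0<q) (0 , λ _ _ →
  subst₂ ℚ._<_ (ℚₚ.+-identityʳ (½ ℚ.* q)) (half+half q) (ℚₚ.+-monoʳ-< (½ ℚ.* q) (0<half 0<q)))

-- Since y stays below some `B`, the inequalities ε < x y and 0 < y force x > ε/B.
positive-cancelʳ : ∀ x y → Positive (x * y) → Positive y → Positive x
positive-cancelʳ x y (mkPos ε 0<ε ε<xy) (mkPos δ 0<δ δ<y) =
  let (B , 0<B , ∣y∣≤B) = bounded {approx y} (cauchy y)
      (η , 0<η , η*B≡ε) = divide 0<ε 0<B
  in mkPos η 0<η (eventually (λ n (ε<xy , δ<y) →
       ℚₚ.*-cancelʳ-<-nonNeg (approx y n) {{ℚ.nonNegative (ℚₚ.<⇒≤ (ℚₚ.<-trans 0<δ δ<y))}}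
         (ℚₚ.≤-<-trans (*-monoˡ (ℚₚ.<⇒≤ 0<η) (ℚₚ.≤-trans (p≤∣p∣ (approx y n)) (∣y∣≤B n)))
           (subst (ℚ._< approx x n ℚ.* approx y n) (sym η*B≡ε) ε<xy)))
     (both ε<xy δ<y))

-- Addition formula and sign of the sine

sin-+ : ∀ x y → sin (x + y) ≋ sin x * cos y + cos x * sin y
sin-+ x y = ≈⇒≋ (sin (x + y)) (sin x * cos y + cos x * sin y) λ ε 0<ε →
  let (A , 0<A , ∣x∣≤A) = bounded {approx x} (cauchy x)
      (B , 0<B , ∣y∣≤B) = bounded {approx y} (cauchy y)
      0≤A = ℚₚ.<⇒≤ 0<A
      0≤B = ℚₚ.<⇒≤ 0<B
      A≤A+B = subst (ℚ._≤ A ℚ.+ B) (ℚₚ.+-identityʳ A) (ℚₚ.+-monoʳ-≤ A 0≤B)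
      B≤A+B = subst (ℚ._≤ A ℚ.+ B) (ℚₚ.+-identityˡ B) (ℚₚ.+-monoˡ-≤ B 0≤A)
      -- `A + B` is a common bound for all approximations of both arguments, as the uniform estimate
      -- requires.
      (N , small) = sinPoly-+-error (A ℚ.+ B) ε (ℚₚ.+-mono-≤ 0≤A 0≤B) 0<ε
  in N , λ n N≤n → small n N≤n (approx x n) (approx y n)
       (ℚₚ.≤-trans (∣x∣≤A n) A≤A+B) (ℚₚ.≤-trans (∣y∣≤B n) B≤A+B)

-- The factors are ordered so that for x = θⱼ and y = θᵢ the right side is literally a determinant
-- `σ i j` of cosines and sines.
sin-- : ∀ x y → sin (x - y) ≋ cos y * sin x - cos x * sin y
sin-- x y = ∼-trans (sin-+ x (- y))
  (≗⇒≋ (sin x * cos (- y) + cos x * sin (- y)) (cos y * sin x - cos x * sin y) λ n → trans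
    (cong₂ (λ c s → approx (sin x) n ℚ.* c ℚ.+ approx (cos x) n ℚ.* s)
      (cosPoly-neg n (approx y n)) (sinPoly-neg n (approx y n)))
    (solve 4 (λ a b c d → a :* b :+ c :* (:- d) := b :* a :- c :* d) refl
      (approx (sin x) n) (approx (cos y) n) (approx (cos x) n) (approx (sin y) n)))

0<π/2 : Positive π/2
0<π/2 = 0<⇒positive π/2 (proj₁ 0<π/2<2)

π/2-InI : Eventually (λ n → RationalSequences.InI (approx π/2 n))
π/2-InI = from 5 RationalSequences.halfPiSeq-InI

-- For 0 < h < π/2 the approximations of h eventually lie in (0 , 17/10), where
-- the estimates of the Taylor polynomials hold.
module _ (h : ℝ) (0<h : Positive h) (h<π/2 : Positive (π/2 - h)) where

  private
    range : Eventually (λ n → (0ℚ ℚ.≤ approx h n × approx h n ℚ.≤ approx π/2 n) × approx π/2 n ℚ.≤ nat 2)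
    range =
      let mkPos ε 0<ε ε<h = 0<h
          mkPos δ 0<δ δ<π/2-h = h<π/2
      in eventually (λ n ((ε<h , δ<π/2-h) , inI) →
           (ℚₚ.<⇒≤ (ℚₚ.<-trans 0<ε ε<h) ,
            subst₂ ℚ._≤_ (ℚₚ.+-identityʳ _)
              (solve 2 (λ h p → h :+ (p :- h) := p) refl (approx h n) (approx π/2 n))
              (ℚₚ.+-monoʳ-≤ (approx h n) (ℚₚ.<⇒≤ (ℚₚ.<-trans 0<δ δ<π/2-h)))) ,
           RationalSequences.InI≤2 inI)
         (both (both ε<h δ<π/2-h) π/2-InI)

  sin-positive : Positive (sin h)
  sin-positive = pos-mono
    (eventually (λ n (((0≤h , h≤p) , p≤2) , lower) → lower 0≤h (ℚₚ.≤-trans h≤p p≤2))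
      (both range (from {λ n → 0ℚ ℚ.≤ approx h n → approx h n ℚ.≤ nat 2 →
                             approx (fromℚ (ℤ.+ 1 ℚ./ 3) * h) n ℚ.≤ approx (sin h) n}
        3 (λ m → sinPoly-lower m))))
    (pos-const (ℚₚ.positive⁻¹ (ℤ.+ 1 ℚ./ 3)) *ₚ 0<h)

  -- From h to π/2 the cosine drops by at least `gap`, and it ends at 0.
  cos-positive : Positive (cos h)
  cos-positive = pos-mono
    (eventually (λ n (((0≤h , h≤p) , p≤2) , lower) → lower 0≤h h≤p p≤2)
      (both range (from {λ n → 0ℚ ℚ.≤ approx h n → approx h n ℚ.≤ approx π/2 n → approx π/2 n ℚ.≤ nat 2 →
                             approx (cos π/2 + gap) n ℚ.≤ approx (cos h) n}
        4 (λ m → cosPoly-decrease m))))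
    (pos-∼ (∼-sym (≈⇒≋ (cos π/2) 0ℝ cos[π/2]≈0) ⊕ ≋-refl gap)
      (pos-≗ (λ n → sym (ℚₚ.+-identityˡ (approx gap n)))
        (h<π/2 *ₚ (0<π/2 +ₚ 0<h) *ₚ pos-const (ℚₚ.positive⁻¹ (ℤ.+ 1 ℚ./ 6)))))
    where gap = (π/2 - h) * (π/2 + h) * fromℚ (ℤ.+ 1 ℚ./ 6)

  -- Doubling carries positivity from (0, π/2) to (0, π), beyond the reach of the polynomial
  -- estimates.
  sin-double-positive : Positive (sin (h + h))
  sin-double-positive = pos-∼ (∼-sym (sin-+ h h)) (sin-positive *ₚ cos-positive +ₚ cos-positive *ₚ sin-positive)

degree : ℝ
degree = π * fromℚ (ℤ.+ 1 ℚ./ 180)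

sin°-positive : ∀ α → Positive α → Positive (180° - α) → Positive (sin° α)
sin°-positive α 0<α α<180 = pos-≗
  (λ n → cong (RationalSequences.sinPoly n)
    (solve 3 (λ α p c → α :* (p :* c) :+ α :* (p :* c) := α :* ((p :+ p) :* c)) refl
      (approx α n) (approx π/2 n) (ℤ.+ 1 ℚ./ 180)))
  -- `c` converts degrees to radians and halves the angle. The bound on `α * c` is (180 - α) c = π/2
  -- - α c, where 180 times 1/180 evaluates to 1.
  (sin-double-positive (α * c) (0<α *ₚ 0<c)
    (pos-≗ (λ n → trans
        (solve 4 (λ α p c d → (d :- α) :* (p :* c) := (d :* c) :* p :- α :* (p :* c)) refl
          (approx α n) (approx π/2 n) (ℤ.+ 1 ℚ./ 180) (ℤ.+ 180 ℚ./ 1))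
        (cong (ℚ._- approx (α * c) n) (ℚₚ.*-identityˡ (approx π/2 n))))
      (α<180 *ₚ 0<c)))
  where
  c = π/2 * fromℚ (ℤ.+ 1 ℚ./ 180)
  0<c : Positive c
  0<c = 0<π/2 *ₚ pos-const (ℚₚ.positive⁻¹ (ℤ.+ 1 ℚ./ 180))

-- Sines of the differences of line angles

-- The right side is the determinant of the unit normals of lines i and j.
s≋ : ∀ {n} (θ : Fin n → ℝ) i j → s θ i j ≋
  cos (θ i * degree) * sin (θ j * degree) - cos (θ j * degree) * sin (θ i * degree)
s≋ θ i j = ∼-trans
  (≗⇒≋ (s θ i j) (sin (θ j * degree - θ i * degree)) λ n → cong (RationalSequences.sinPoly n)
    (solve 3 (λ x y d → (x :- y) :* d := x :* d :- y :* d) refl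
      (approx (θ j) n) (approx (θ i) n) (approx degree n)))
  (sin-- (θ j * degree) (θ i * degree))

s-positive : ∀ {n} (θ : Fin n → ℝ) i j k → Ordered θ i j k →
  Positive (s θ i j) × Positive (s θ j k) × Positive (s θ i k)
s-positive θ i j k (0<i , i<j , j<k , k<180) =
  sin-diff i j 0<θi j-i 180-j ,
  sin-diff j k
    (pos-≗ (λ n → solve 2 (λ x y → (y :- x) :+ x := y) refl (approx (θ i) n) (approx (θ j) n))
      (j-i +ₚ 0<θi)) k-j 180-k ,
  sin-diff i k 0<θi
    (pos-≗ (λ n → solve 3 (λ x y z → (z :- y) :+ (y :- x) := z :- x) refl
        (approx (θ i) n) (approx (θ j) n) (approx (θ k) n))
      (k-j +ₚ j-i)) 180-k
  where
  0<θi = 0<⇒positive (θ i) 0<i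
  j-i = <⇒positive (θ i) (θ j) i<j
  k-j = <⇒positive (θ j) (θ k) j<k
  180-k = <⇒positive (θ k) 180° k<180
  180-j : Positive (180° - θ j)
  180-j = pos-≗ (λ n → solve 3 (λ t y z → (t :- z) :+ (z :- y) := t :- y) refl
    (approx 180° n) (approx (θ j) n) (approx (θ k) n)) (180-k +ₚ k-j)
  sin-diff : ∀ i j → Positive (θ i) → Positive (θ j - θ i) → Positive (180° - θ j) → Positive (s θ i j)
  sin-diff i j 0<x x<y y<180 = sin°-positive (θ j - θ i) x<y
    (pos-≗ (λ n → solve 3 (λ t x y → (t :- y) :+ x := t :- (y :- x)) refl
      (approx 180° n) (approx (θ i) n) (approx (θ j) n)) (y<180 +ₚ 0<x))

-- Orientation brackets and translation of the origin

-- For t = `s θ` these unfold to the expressions in the orientation conditions; for t = `σ` they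
-- become polynomials in the normals, within reach of the ring solver.
module Brackets {m : ℕ} (r : Fin m → ℝ) (t : Fin m → Fin m → ℝ) where

  pos neg : Fin m → Fin m → Fin m → ℝ
  pos i j k = r i * t j k - r j * t i k + r k * t i j
  neg i j k = - r i * t j k + r j * t i k - r k * t i j

module _ {m : ℕ} (r : Fin m → ℝ) (t t′ : Fin m → Fin m → ℝ) (t≋t′ : ∀ i j → t i j ≋ t′ i j) where

  open Brackets

  pos-cong : ∀ i j k → pos r t i j k ≋ pos r t′ i j k
  pos-cong i j k = ≋-refl (r i) ⊗ t≋t′ j k ⊖ ≋-refl (r j) ⊗ t≋t′ i k ⊕ ≋-refl (r k) ⊗ t≋t′ i j

  neg-cong : ∀ i j k → neg r t i j k ≋ neg r t′ i j k
  neg-cong i j k = ⊝ ≋-refl (r i) ⊗ t≋t′ j k ⊕ ≋-refl (r j) ⊗ t≋t′ i k ⊖ ≋-refl (r k) ⊗ t≋t′ i j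

module Translation {m : ℕ} (a b r : Fin m → ℝ) where

  σ : Fin m → Fin m → ℝ
  σ i j = a i * b j - a j * b i

  open Brackets r σ public

  -- `pos i j k` is the determinant with rows (a, b, r). Now `neg p i q` is `σ p q * r i` plus a
  -- combination of `a i` and `b i` whose coefficients depend only on p and q, so putting it in
  -- place of the column r multiplies the determinant by `σ p q`.
  pos-translated : ∀ p q i j k n →
    approx (σ p q * pos i j k) n ≡ approx (neg p i q * σ j k - neg p j q * σ i k + neg p k q * σ i j) n
  pos-translated p q i j k n = solve 15
    (λ a b r a′ b′ r′ a₁ b₁ r₁ a₂ b₂ r₂ a₃ b₃ r₃ →
      let σ = λ a b a′ b′ → a :* b′ :- a′ :* b
          h = λ a₁ b₁ r₁ → :- r :* σ a₁ b₁ a′ b′ :+ r₁ :* σ a b a′ b′ :- r′ :* σ a b a₁ b₁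
      in σ a b a′ b′ :* (r₁ :* σ a₂ b₂ a₃ b₃ :- r₂ :* σ a₁ b₁ a₃ b₃ :+ r₃ :* σ a₁ b₁ a₂ b₂)
         := h a₁ b₁ r₁ :* σ a₂ b₂ a₃ b₃ :- h a₂ b₂ r₂ :* σ a₁ b₁ a₃ b₃ :+ h a₃ b₃ r₃ :* σ a₁ b₁ a₂ b₂)
    refl (approx (a p) n) (approx (b p) n) (approx (r p) n) (approx (a q) n) (approx (b q) n) (approx (r q) n)
    (approx (a i) n) (approx (b i) n) (approx (r i) n) (approx (a j) n) (approx (b j) n) (approx (r j) n)
    (approx (a k) n) (approx (b k) n) (approx (r k) n)

  neg-translated : ∀ p q i j k n →
    approx (σ p q * neg i j k) n ≡ approx (- neg p i q * σ j k + neg p j q * σ i k - neg p k q * σ i j) n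
  neg-translated p q i j k n = trans
    (solve 7 (λ s r₁ r₂ r₃ x y z → s :* (:- r₁ :* x :+ r₂ :* y :- r₃ :* z)
        := :- (s :* (r₁ :* x :- r₂ :* y :+ r₃ :* z))) refl
      (approx (σ p q) n) (approx (r i) n) (approx (r j) n) (approx (r k) n)
      (approx (σ j k) n) (approx (σ i k) n) (approx (σ i j) n))
    (trans (cong ℚ.-_ (pos-translated p q i j k n))
      (solve 6 (λ u v w x y z → :- (u :* x :- v :* y :+ w :* z) := :- u :* x :+ v :* y :- w :* z) refl
        (approx (neg p i q) n) (approx (neg p j q) n) (approx (neg p k q) n)
        (approx (σ j k) n) (approx (σ i k) n) (approx (σ i j) n)))

  -- The case i = p of `pos-translated`: `neg p p q` vanishes, so its term drops out.
  pos-translatedˡ : ∀ p q j k n →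
    approx (σ p q * pos p j k) n ≡ approx (neg p k q * σ p j - neg p j q * σ p k) n
  pos-translatedˡ p q j k n = solve 12
    (λ a b r a′ b′ r′ a₂ b₂ r₂ a₃ b₃ r₃ →
      let σ = λ a b a′ b′ → a :* b′ :- a′ :* b
          h = λ a₁ b₁ r₁ → :- r :* σ a₁ b₁ a′ b′ :+ r₁ :* σ a b a′ b′ :- r′ :* σ a b a₁ b₁
      in σ a b a′ b′ :* (r :* σ a₂ b₂ a₃ b₃ :- r₂ :* σ a b a₃ b₃ :+ r₃ :* σ a b a₂ b₂)
         := h a₃ b₃ r₃ :* σ a b a₂ b₂ :- h a₂ b₂ r₂ :* σ a b a₃ b₃)
    refl (approx (a p) n) (approx (b p) n) (approx (r p) n) (approx (a q) n) (approx (b q) n) (approx (r q) n)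
    (approx (a j) n) (approx (b j) n) (approx (r j) n) (approx (a k) n) (approx (b k) n) (approx (r k) n)

  -- The case j = q of `neg-translated`: `neg p q q` vanishes, so its term drops out.
  neg-translatedᵐ : ∀ p q i k n →
    approx (σ p q * neg i q k) n ≡ approx (- neg p i q * σ q k - neg p k q * σ i q) n
  neg-translatedᵐ p q i k n = solve 12
    (λ a b r a′ b′ r′ a₁ b₁ r₁ a₃ b₃ r₃ →
      let σ = λ a b a′ b′ → a :* b′ :- a′ :* b
          h = λ a₁ b₁ r₁ → :- r :* σ a₁ b₁ a′ b′ :+ r₁ :* σ a b a′ b′ :- r′ :* σ a b a₁ b₁
      in σ a b a′ b′ :* (:- r₁ :* σ a′ b′ a₃ b₃ :+ r′ :* σ a₁ b₁ a₃ b₃ :- r₃ :* σ a₁ b₁ a′ b′)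
         := :- h a₁ b₁ r₁ :* σ a′ b′ a₃ b₃ :- h a₃ b₃ r₃ :* σ a₁ b₁ a′ b′)
    refl (approx (a p) n) (approx (b p) n) (approx (r p) n) (approx (a q) n) (approx (b q) n) (approx (r q) n)
    (approx (a i) n) (approx (b i) n) (approx (r i) n) (approx (a k) n) (approx (b k) n) (approx (r k) n)

  pos≡-neg : ∀ i j k n → approx (pos i j k) n ≡ approx (- neg i j k) n
  pos≡-neg i j k n = solve 6 (λ u v w x y z → u :* x :- v :* y :+ w :* z := :- (:- u :* x :+ v :* y :- w :* z))
    refl (approx (r i) n) (approx (r j) n) (approx (r k) n) (approx (σ j k) n) (approx (σ i k) n) (approx (σ i j) n)

-- Positivity of the expression

expression : (Fin 10 → Fin 10 → ℝ) → ℝ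
expression t =
  t ℓ₈ ℓ₉ * t ℓ₁ ℓ₁₀ * t ℓ₂ ℓ₄ * t ℓ₃ ℓ₅ * t ℓ₆ ℓ₇
  + t ℓ₄ ℓ₆ * t ℓ₁ ℓ₉ * t ℓ₇ ℓ₁₀ * t ℓ₃ ℓ₅ * t ℓ₂ ℓ₈
  - t ℓ₄ ℓ₆ * t ℓ₃ ℓ₈ * t ℓ₇ ℓ₁₀ * t ℓ₂ ℓ₉ * t ℓ₁ ℓ₅

expression-cong : ∀ t t′ → (∀ i j → t i j ≋ t′ i j) → expression t ≋ expression t′
expression-cong t t′ t≋t′ =
  t≋t′ ℓ₈ ℓ₉ ⊗ t≋t′ ℓ₁ ℓ₁₀ ⊗ t≋t′ ℓ₂ ℓ₄ ⊗ t≋t′ ℓ₃ ℓ₅ ⊗ t≋t′ ℓ₆ ℓ₇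
  ⊕ t≋t′ ℓ₄ ℓ₆ ⊗ t≋t′ ℓ₁ ℓ₉ ⊗ t≋t′ ℓ₇ ℓ₁₀ ⊗ t≋t′ ℓ₃ ℓ₅ ⊗ t≋t′ ℓ₂ ℓ₈
  ⊖ t≋t′ ℓ₄ ℓ₆ ⊗ t≋t′ ℓ₃ ℓ₈ ⊗ t≋t′ ℓ₇ ℓ₁₀ ⊗ t≋t′ ℓ₂ ℓ₉ ⊗ t≋t′ ℓ₁ ℓ₅

theoremt :
  (r θ : Fin 10 → ℝ) →
  Ordered θ ℓ₂ ℓ₄ ℓ₆  → PositivelyOriented r θ ℓ₂ ℓ₄ ℓ₆ →
  Ordered θ ℓ₁ ℓ₅ ℓ₉  → PositivelyOriented r θ ℓ₁ ℓ₅ ℓ₉ →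
  Ordered θ ℓ₁ ℓ₅ ℓ₁₀ → PositivelyOriented r θ ℓ₁ ℓ₅ ℓ₁₀ →
  Ordered θ ℓ₁ ℓ₅ ℓ₇  → PositivelyOriented r θ ℓ₁ ℓ₅ ℓ₇ →
  Ordered θ ℓ₁ ℓ₃ ℓ₇  → NegativelyOriented r θ ℓ₁ ℓ₃ ℓ₇ →
  Ordered θ ℓ₁ ℓ₄ ℓ₇  → NegativelyOriented r θ ℓ₁ ℓ₄ ℓ₇ →
  Ordered θ ℓ₃ ℓ₅ ℓ₈  → NegativelyOriented r θ ℓ₃ ℓ₅ ℓ₈ →
  Ordered θ ℓ₂ ℓ₈ ℓ₉  → NegativelyOriented r θ ℓ₂ ℓ₈ ℓ₉ →
  Ordered θ ℓ₆ ℓ₇ ℓ₁₀ → NegativelyOriented r θ ℓ₆ ℓ₇ ℓ₁₀ →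
  0ℝ < s θ ℓ₈ ℓ₉ * s θ ℓ₁ ℓ₁₀ * s θ ℓ₂ ℓ₄ * s θ ℓ₃ ℓ₅ * s θ ℓ₆ ℓ₇
     + s θ ℓ₄ ℓ₆ * s θ ℓ₁ ℓ₉ * s θ ℓ₇ ℓ₁₀ * s θ ℓ₃ ℓ₅ * s θ ℓ₂ ℓ₈
     - s θ ℓ₄ ℓ₆ * s θ ℓ₃ ℓ₈ * s θ ℓ₇ ℓ₁₀ * s θ ℓ₂ ℓ₉ * s θ ℓ₁ ℓ₅
theoremt r θ o246 p246 o159 p159 o1510 p1510 o157 p157 o137 n137 o147 n147 o358 n358 o289 n289 o6710 n6710 =
  positive⇒0< (expression (s θ)) (pos-∼ (∼-sym (expression-cong (s θ) σ (s≋ θ)))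
    (positive-cancelʳ (expression σ) (- h ℓ₅)
      (pos-≗ (λ n → elimination
          (approx (h ℓ₂) n) (approx (h ℓ₃) n) (approx (h ℓ₄) n) (approx (h ℓ₅) n)
          (approx (h ℓ₆) n) (approx (h ℓ₈) n) (approx (h ℓ₉) n) (approx (h ℓ₁₀) n)
          (approx (σ ℓ₁ ℓ₅) n) (approx (σ ℓ₁ ℓ₉) n) (approx (σ ℓ₁ ℓ₁₀) n) (approx (σ ℓ₂ ℓ₄) n)
          (approx (σ ℓ₂ ℓ₆) n) (approx (σ ℓ₂ ℓ₈) n) (approx (σ ℓ₂ ℓ₉) n) (approx (σ ℓ₃ ℓ₅) n)
          (approx (σ ℓ₃ ℓ₈) n) (approx (σ ℓ₄ ℓ₆) n) (approx (σ ℓ₅ ℓ₈) n) (approx (σ ℓ₆ ℓ₇) n)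
          (approx (σ ℓ₇ ℓ₁₀) n) (approx (σ ℓ₈ ℓ₉) n))
        -- Positivity of the left side of `elimination`, summand by summand in the same order.
        (s₁₅ *ₚ s₃₅ *ₚ s₇₁₀ *ₚ (s₈₉ *ₚ h246 +ₚ s₈₉ *ₚ s₂₆ *ₚ h₄ +ₚ s₄₆ *ₚ h289)
          +ₚ s₇₁₀ *ₚ s₁₅ *ₚ s₄₆ *ₚ s₂₉ *ₚ (h358 +ₚ h₃ *ₚ s₅₈)
          +ₚ s₄₆ *ₚ s₂₈ *ₚ s₃₅ *ₚ s₇₁₀ *ₚ h159
          +ₚ s₈₉ *ₚ s₂₄ *ₚ s₁₅ *ₚ s₃₅ *ₚ h6710
          +ₚ s₈₉ *ₚ s₂₄ *ₚ s₃₅ *ₚ s₆₇ *ₚ h1510))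
      (pos-≗ (pos≡-neg ℓ₁ ℓ₅ ℓ₇) (bracket⁺ ℓ₁ ℓ₅ ℓ₇ p157))))
  where
  open Translation (λ i → cos (θ i * degree)) (λ i → sin (θ i * degree)) r

  h : Fin 10 → ℝ
  h i = neg ℓ₁ i ℓ₇

  bracket⁺ : ∀ i j k → PositivelyOriented r θ i j k → Positive (pos i j k)
  bracket⁺ i j k p = pos-∼ (pos-cong r (s θ) σ (s≋ θ) i j k) (0<⇒positive (Brackets.pos r (s θ) i j k) p)

  bracket⁻ : ∀ i j k → NegativelyOriented r θ i j k → Positive (neg i j k)
  bracket⁻ i j k p = pos-∼ (neg-cong r (s θ) σ (s≋ θ) i j k) (0<⇒positive (Brackets.neg r (s θ) i j k) p)

  σ-positive : ∀ i j k → Ordered θ i j k → Positive (σ i j) × Positive (σ j k) × Positive (σ i k)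
  σ-positive i j k o =
    let (p , q , r) = s-positive θ i j k o in pos-∼ (s≋ θ i j) p , pos-∼ (s≋ θ j k) q , pos-∼ (s≋ θ i k) r

  σ246 = σ-positive ℓ₂ ℓ₄ ℓ₆ o246
  σ157 = σ-positive ℓ₁ ℓ₅ ℓ₇ o157
  σ358 = σ-positive ℓ₃ ℓ₅ ℓ₈ o358
  σ289 = σ-positive ℓ₂ ℓ₈ ℓ₉ o289
  σ6710 = σ-positive ℓ₆ ℓ₇ ℓ₁₀ o6710

  s₁₅ = proj₁ σ157
  s₁₇ = proj₂ (proj₂ σ157)
  s₂₄ = proj₁ σ246
  s₄₆ = proj₁ (proj₂ σ246)
  s₂₆ = proj₂ (proj₂ σ246)
  s₃₅ = proj₁ σ358
  s₅₈ = proj₁ (proj₂ σ358)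
  s₂₈ = proj₁ σ289
  s₈₉ = proj₁ (proj₂ σ289)
  s₂₉ = proj₂ (proj₂ σ289)
  s₆₇ = proj₁ σ6710
  s₇₁₀ = proj₁ (proj₂ σ6710)

  -- Negative triples (1,i,7) are values of `h` as they stand.
  h₃ = bracket⁻ ℓ₁ ℓ₃ ℓ₇ n137
  h₄ = bracket⁻ ℓ₁ ℓ₄ ℓ₇ n147
  h246 = pos-≗ (pos-translated ℓ₁ ℓ₇ ℓ₂ ℓ₄ ℓ₆) (s₁₇ *ₚ bracket⁺ ℓ₂ ℓ₄ ℓ₆ p246)
  h159 = pos-≗ (pos-translatedˡ ℓ₁ ℓ₇ ℓ₅ ℓ₉) (s₁₇ *ₚ bracket⁺ ℓ₁ ℓ₅ ℓ₉ p159)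
  h1510 = pos-≗ (pos-translatedˡ ℓ₁ ℓ₇ ℓ₅ ℓ₁₀) (s₁₇ *ₚ bracket⁺ ℓ₁ ℓ₅ ℓ₁₀ p1510)
  h358 = pos-≗ (neg-translated ℓ₁ ℓ₇ ℓ₃ ℓ₅ ℓ₈) (s₁₇ *ₚ bracket⁻ ℓ₃ ℓ₅ ℓ₈ n358)
  h289 = pos-≗ (neg-translated ℓ₁ ℓ₇ ℓ₂ ℓ₈ ℓ₉) (s₁₇ *ₚ bracket⁻ ℓ₂ ℓ₈ ℓ₉ n289)
  h6710 = pos-≗ (neg-translatedᵐ ℓ₁ ℓ₇ ℓ₆ ℓ₁₀) (s₁₇ *ₚ bracket⁻ ℓ₆ ℓ₇ ℓ₁₀ n6710)
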